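{- Let $G$ be a unicyclic graph with $n \ge 4$ vertices and maximum degree $\Delta\ge 3$, let $q=\lfloor \frac{n}{\Delta-1}\rfloor$, and let $a$ be a real number with $a>1$ or $0<a\le e^{ -2}$. If $q=1$ or $n=2\Delta-2$, then $$ SEI_a(G) \le \Delta\, a^\Delta + (n-\Delta+1)\,a^{n-\Delta+1} + 2a^2 + (n-3)\,a. $$ If $q>1$ and $n\ne 2\Delta-2$, then $$ SEI_a(G) \le q\,\Delta\, a^\Delta + \big(n-q(\Delta-1)+1\big)\,a^{n-q(\Delta-1)+1} + (n-q-1)\,a. $$ Moreover, in each case the upper bound is attained if and only if $G\in\mathcal{K}_n^\Delta$.
   Context: All graphs are finite, connected, simple (no loops, no multiple edges) and have at least one edge. A unicyclic graph is a graph containing exactly one cycle. For a vertex $u$ of $G$, $d_u$ denotes its degree. For a positive real number $a\ne 1$, the variable sum exdeg index is $SEI_a(G)=\sum_{uv\in E(G)}(a^{d_u}+a^{d_v})=\sum_{u\in V(G)} d_u a^{d_u}$. For $n\ge 4$, $3\le\Delta\le n-1$ and $q=\lfloor \frac{n}{\Delta-1}\rfloor$, define the $n$-tuple $\mathbf{z}$ as follows. If $q=1$ or $n=2\Delta-2$, then $\mathbf{z}=(\Delta,\,n-\Delta+1,\,2,\,1,\dots,1)$ with $n-3$ entries equal to $1$ at the end. If $q\ge 2$ and $n\ne 2\Delta-2$, then $\mathbf{z}=(z_1,\dots,z_n)$ with $z_j=\Delta$ for $1\le j\le q$, $z_{q+1}=n-q(\Delta-1)+1$, and $z_j=1$ for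 $q+1<j\le n$. $\mathcal{K}_n^\Delta$ is the set of unicyclic graphs with $n$ vertices whose degree sequence (in non-increasing order) is $\mathbf{z}$. -}

module Defs where

open import Level using (0ℓ)
open import Algebra.Bundles.Raw using (RawSemiring)
import Algebra.Definitions.RawMonoid as RawMonoidDefinitions
import Algebra.Definitions.RawSemiring as RawSemiringDefinitions
open import Data.Bool.Base using (if_then_else_)
open import Data.Fin.Base as Fin using (Fin)
import Data.Fin.Properties as Finₚ
open import Data.Integer.Base as ℤ using (+_)
import Data.Integer.Properties as ℤₚ
open import Data.List.Base
  using (List; []; _∷_; _++_; map; foldr; filter; length; zip; replicate; allFin; cartesianProduct)
open import Data.List.Extrema.Nat using (max)
open import Data.List.Membership.Propositional using (_∈_)
open import Data.List.Relation.Unary.Linked using (Linked)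
open import Data.List.Relation.Unary.Unique.Propositional using (Unique)
import Data.List.Sort as Sort
open import Data.Nat.Base as ℕ using (ℕ; zero; suc; _∸_; _!)
import Data.Nat.DivMod as ℕ
import Data.Nat.Properties as ℕₚ
open import Data.Product.Base using (Σ; ∃-syntax; ∃₂; _×_; _,_; proj₁; proj₂)
open import Data.Rational.Base as ℚ using (ℚ; 0ℚ; 1ℚ; ½; ∣_∣; _/_)
import Data.Rational.Properties as ℚₚ
import Data.Rational.Unnormalised.Base as ℚᵘ
import Data.Rational.Unnormalised.Properties as ℚᵘₚ
open import Data.Sum.Base using (_⊎_)
open import Function.Bundles using (_⇔_)
open import Relation.Binary.Bundles using (DecTotalOrder)
open import Relation.Binary.Construct.Closure.ReflexiveTransitive using (Star)
import Relation.Binary.Construct.Flip.EqAndOrd as Flip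
open import Relation.Binary.Core using (Rel)
open import Relation.Binary.Definitions using (Decidable; Symmetric; Irreflexive)
open import Relation.Binary.PropositionalEquality
open import Relation.Nullary.Decidable using (does; dec⇒maybe; _×-dec_; _⊎-dec_)
open import Relation.Unary using (Pred)
open import Tactic.RingSolver using (solve-∀)
import Tactic.RingSolver.Core.AlmostCommutativeRing as ACR

open RawSemiringDefinitions ℚ.+-*-rawSemiring using () renaming (_^_ to _^ℚ_)

-- Real numbers are Cauchy sequences of rationals; real equality is _≈ℝ_, not _≡_.

Eventually : Pred ℕ 0ℓ → Set
Eventually P = ∃[ N ] ∀ n → N ℕ.≤ n → P n

IsCauchy : (ℕ → ℚ) → Set
IsCauchy s = ∀ ε → 0ℚ ℚ.< ε →
  ∃[ N ] ∀ m n → N ℕ.≤ m → N ℕ.≤ n → ∣ s m ℚ.- s n ∣ ℚ.< ε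

record ℝ : Set where
  constructor mkℝ
  field
    seq    : ℕ → ℚ
    cauchy : IsCauchy seq
open ℝ public

infix 4 _≈ℝ_ _≤ℝ_ _<ℝ_

_≈ℝ_ : Rel ℝ 0ℓ
x ≈ℝ y = ∀ ε → 0ℚ ℚ.< ε → Eventually λ n → ∣ seq x n ℚ.- seq y n ∣ ℚ.< ε

_≤ℝ_ : Rel ℝ 0ℓ
x ≤ℝ y = ∀ ε → 0ℚ ℚ.< ε → Eventually λ n → seq x n ℚ.< seq y n ℚ.+ ε

_<ℝ_ : Rel ℝ 0ℓ
x <ℝ y = ∃[ ε ] 0ℚ ℚ.< ε × Eventually λ n → seq x n ℚ.+ ε ℚ.< seq y n

private
  ℚ-ring : ACR.AlmostCommutativeRing 0ℓ 0ℓ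
  ℚ-ring = ACR.fromCommutativeRing ℚₚ.+-*-commutativeRing λ q → dec⇒maybe (0ℚ ℚₚ.≟ q)

  half-pos : ∀ {ε} → 0ℚ ℚ.< ε → 0ℚ ℚ.< ½ ℚ.* ε
  half-pos {ε} 0<ε = ℚₚ.positive⁻¹ (½ ℚ.* ε)
    where
    instance
      _ = ℚ.positive 0<ε
      _ = ℚₚ.pos*pos⇒pos ½ ε

  half+half : ∀ ε → ½ ℚ.* ε ℚ.+ ½ ℚ.* ε ≡ ε
  half+half ε = trans (sym (ℚₚ.*-distribʳ-+ ε ½ ½)) (ℚₚ.*-identityˡ ε)

  const-cauchy : ∀ q → IsCauchy (λ _ → q)
  const-cauchy q ε 0<ε = 0 , λ _ _ _ _ →
    subst (λ z → ∣ z ∣ ℚ.< ε) (sym (ℚₚ.+-inverseʳ q)) 0<ε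

  +-cauchy : ∀ s t → IsCauchy s → IsCauchy t → IsCauchy (λ n → s n ℚ.+ t n)
  +-cauchy s t cs ct ε 0<ε with cs (½ ℚ.* ε) (half-pos 0<ε) | ct (½ ℚ.* ε) (half-pos 0<ε)
  ... | M , hM | N , hN = M ℕ.⊔ N , λ m n m≥ n≥ →
    let open ℚₚ.≤-Reasoning in begin-strict
      ∣ (s m ℚ.+ t m) ℚ.- (s n ℚ.+ t n) ∣        ≡⟨ cong ∣_∣ (regroup (s m) (t m) (s n) (t n)) ⟩
      ∣ (s m ℚ.- s n) ℚ.+ (t m ℚ.- t n) ∣        ≤⟨ ℚₚ.∣p+q∣≤∣p∣+∣q∣ (s m ℚ.- s n) (t m ℚ.- t n) ⟩
      ∣ s m ℚ.- s n ∣ ℚ.+ ∣ t m ℚ.- t n ∣        <⟨ ℚₚ.+-mono-<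
                                                     (hM m n (ℕₚ.m⊔n≤o⇒m≤o M N m≥) (ℕₚ.m⊔n≤o⇒m≤o M N n≥))
                                                     (hN m n (ℕₚ.m⊔n≤o⇒n≤o M N m≥) (ℕₚ.m⊔n≤o⇒n≤o M N n≥)) ⟩
      ½ ℚ.* ε ℚ.+ ½ ℚ.* ε                        ≡⟨ half+half ε ⟩
      ε                                          ∎
    where
    regroup : ∀ a b c d → (a ℚ.+ b) ℚ.- (c ℚ.+ d) ≡ (a ℚ.- c) ℚ.+ (b ℚ.- d)
    regroup = solve-∀ ℚ-ring

  cauchy-bounded : ∀ {s} → IsCauchy s → ∃[ B ] 0ℚ ℚ.< B × Eventually λ n → ∣ s n ∣ ℚ.≤ B
  cauchy-bounded {s} cs with cs 1ℚ (ℚₚ.positive⁻¹ 1ℚ)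
  ... | N , h = B , 0<B , N , bound
    where
    B : ℚ
    B = 1ℚ ℚ.+ ∣ s N ∣
    0<B : 0ℚ ℚ.< B
    0<B = ℚₚ.+-mono-<-≤ (ℚₚ.positive⁻¹ 1ℚ) (ℚₚ.0≤∣p∣ (s N))
    split : ∀ a b → a ≡ (a ℚ.- b) ℚ.+ b
    split = solve-∀ ℚ-ring
    bound : ∀ n → N ℕ.≤ n → ∣ s n ∣ ℚ.≤ B
    bound n n≥ = let open ℚₚ.≤-Reasoning in begin
      ∣ s n ∣                        ≡⟨ cong ∣_∣ (split (s n) (s N)) ⟩
      ∣ (s n ℚ.- s N) ℚ.+ s N ∣      ≤⟨ ℚₚ.∣p+q∣≤∣p∣+∣q∣ (s n ℚ.- s N) (s N) ⟩
      ∣ s n ℚ.- s N ∣ ℚ.+ ∣ s N ∣    ≤⟨ ℚₚ.+-monoˡ-≤ ∣ s N ∣ (ℚₚ.<⇒≤ (h n N n≥ ℕₚ.≤-refl)) ⟩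
      B                              ∎

  divide : ∀ {ε B} → 0ℚ ℚ.< ε → 0ℚ ℚ.< B → ∃[ δ ] 0ℚ ℚ.< δ × B ℚ.* δ ≡ ε
  divide {ε} {B} 0<ε 0<B = (ℚ.1/ B) ℚ.* ε , ℚₚ.positive⁻¹ _ , eq
    where
    instance
      _ = ℚ.positive 0<ε
      _ = ℚ.positive 0<B
      _ = ℚₚ.pos⇒nonZero B
      _ = ℚₚ.1/pos⇒pos B
      _ = ℚₚ.pos*pos⇒pos (ℚ.1/ B) ε
    eq : B ℚ.* ((ℚ.1/ B) ℚ.* ε) ≡ ε
    eq = trans (sym (ℚₚ.*-assoc B (ℚ.1/ B) ε))
           (trans (cong (ℚ._* ε) (ℚₚ.*-inverseʳ B)) (ℚₚ.*-identityˡ ε))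

  ∣*∣-small : ∀ {x y B δ} → 0ℚ ℚ.< B → ∣ x ∣ ℚ.≤ B → ∣ y ∣ ℚ.< δ → ∣ x ℚ.* y ∣ ℚ.< B ℚ.* δ
  ∣*∣-small {x} {y} {B} {δ} 0<B x≤ y< = let open ℚₚ.≤-Reasoning in begin-strict
    ∣ x ℚ.* y ∣          ≡⟨ ℚₚ.∣p*q∣≡∣p∣*∣q∣ x y ⟩
    ∣ x ∣ ℚ.* ∣ y ∣      ≤⟨ ℚₚ.*-monoʳ-≤-nonNeg ∣ y ∣ {{ℚₚ.∣-∣-nonNeg y}} x≤ ⟩
    B ℚ.* ∣ y ∣          <⟨ ℚₚ.*-monoʳ-<-pos B {{ℚ.positive 0<B}} y< ⟩
    B ℚ.* δ              ∎

  ∣*-*∣-small : ∀ {a b c d B C β γ} → 0ℚ ℚ.< B → 0ℚ ℚ.< C → ∣ a ∣ ℚ.≤ B → ∣ d ∣ ℚ.≤ C →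
    ∣ b ℚ.- d ∣ ℚ.< β → ∣ a ℚ.- c ∣ ℚ.< γ → ∣ a ℚ.* b ℚ.- c ℚ.* d ∣ ℚ.< B ℚ.* β ℚ.+ C ℚ.* γ
  ∣*-*∣-small {a} {b} {c} {d} {B} {C} {β} {γ} 0<B 0<C a≤ d≤ b-d< a-c< =
    let open ℚₚ.≤-Reasoning in begin-strict
      ∣ a ℚ.* b ℚ.- c ℚ.* d ∣                        ≡⟨ cong ∣_∣ (regroup a b c d) ⟩
      ∣ a ℚ.* (b ℚ.- d) ℚ.+ d ℚ.* (a ℚ.- c) ∣        ≤⟨ ℚₚ.∣p+q∣≤∣p∣+∣q∣ (a ℚ.* (b ℚ.- d)) (d ℚ.* (a ℚ.- c)) ⟩
      ∣ a ℚ.* (b ℚ.- d) ∣ ℚ.+ ∣ d ℚ.* (a ℚ.- c) ∣    <⟨ ℚₚ.+-mono-< (∣*∣-small {a} {b ℚ.- d} 0<B a≤ b-d<)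
                                                                    (∣*∣-small {d} {a ℚ.- c} 0<C d≤ a-c<) ⟩
      B ℚ.* β ℚ.+ C ℚ.* γ                            ∎
    where
    regroup : ∀ a b c d → a ℚ.* b ℚ.- c ℚ.* d ≡ a ℚ.* (b ℚ.- d) ℚ.+ d ℚ.* (a ℚ.- c)
    regroup = solve-∀ ℚ-ring

  *-cauchy : ∀ s t → IsCauchy s → IsCauchy t → IsCauchy (λ n → s n ℚ.* t n)
  *-cauchy s t cs ct ε 0<ε =
    let B , 0<B , K , hB = cauchy-bounded cs
        C , 0<C , L , hC = cauchy-bounded ct
        β , 0<β , Bβ     = divide (half-pos 0<ε) 0<B
        γ , 0<γ , Cγ     = divide (half-pos 0<ε) 0<C
        M , hM           = ct β 0<β
        N , hN           = cs γ 0<γ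
        P                = (K ℕ.⊔ L) ℕ.⊔ (M ℕ.⊔ N)
        K≤P              = ℕₚ.≤-trans (ℕₚ.m≤m⊔n K L) (ℕₚ.m≤m⊔n (K ℕ.⊔ L) (M ℕ.⊔ N))
        L≤P              = ℕₚ.≤-trans (ℕₚ.m≤n⊔m K L) (ℕₚ.m≤m⊔n (K ℕ.⊔ L) (M ℕ.⊔ N))
        M≤P              = ℕₚ.≤-trans (ℕₚ.m≤m⊔n M N) (ℕₚ.m≤n⊔m (K ℕ.⊔ L) (M ℕ.⊔ N))
        N≤P              = ℕₚ.≤-trans (ℕₚ.m≤n⊔m M N) (ℕₚ.m≤n⊔m (K ℕ.⊔ L) (M ℕ.⊔ N))
    in P , λ m n P≤m P≤n →
      subst (∣ s m ℚ.* t m ℚ.- s n ℚ.* t n ∣ ℚ.<_)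
        (trans (cong₂ ℚ._+_ Bβ Cγ) (half+half ε))
        (∣*-*∣-small {s m} {t m} {s n} {t n} 0<B 0<C
          (hB m (ℕₚ.≤-trans K≤P P≤m)) (hC n (ℕₚ.≤-trans L≤P P≤n))
          (hM m n (ℕₚ.≤-trans M≤P P≤m) (ℕₚ.≤-trans M≤P P≤n))
          (hN m n (ℕₚ.≤-trans N≤P P≤m) (ℕₚ.≤-trans N≤P P≤n)))

fromℚ : ℚ → ℝ
fromℚ q = mkℝ (λ _ → q) (const-cauchy q)

0ℝ 1ℝ : ℝ
0ℝ = fromℚ 0ℚ
1ℝ = fromℚ 1ℚ

infixl 6 _+ℝ_
infixl 7 _*ℝ_

_+ℝ_ : ℝ → ℝ → ℝ
x +ℝ y = mkℝ (λ n → seq x n ℚ.+ seq y n) (+-cauchy (seq x) (seq y) (cauchy x) (cauchy y))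

_*ℝ_ : ℝ → ℝ → ℝ
x *ℝ y = mkℝ (λ n → seq x n ℚ.* seq y n) (*-cauchy (seq x) (seq y) (cauchy x) (cauchy y))

ℝ-rawSemiring : RawSemiring 0ℓ 0ℓ
ℝ-rawSemiring = record
  { Carrier = ℝ ; _≈_ = _≈ℝ_ ; _+_ = _+ℝ_ ; _*_ = _*ℝ_ ; 0# = 0ℝ ; 1# = 1ℝ }

-- k · x is the k-fold sum x + ⋯ + x, and x ^ k the k-fold product.
open RawSemiringDefinitions ℝ-rawSemiring public
  using (_^_) renaming (_×_ to _·_)

∑ : List ℝ → ℝ
∑ = foldr _+ℝ_ 0ℝ

expTerm : ℚ → ℕ → ℚ
expTerm q k = q ^ℚ k ℚ.* _/_ (+ 1) (k !) {{k ℕₚ.!≢0}}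

expPartialSum : ℚ → ℕ → ℚ
expPartialSum q zero    = 0ℚ
expPartialSum q (suc n) = expPartialSum q n ℚ.+ expTerm q n

open RawMonoidDefinitions ℚ.+-0-rawMonoid using () renaming (_×_ to _×ℚ_)

×ℚ-mono : ∀ k {x y} → x ℚ.≤ y → k ×ℚ x ℚ.≤ k ×ℚ y
×ℚ-mono zero    x≤y = ℚₚ.≤-refl
×ℚ-mono (suc k) x≤y = ℚₚ.+-mono-≤ x≤y (×ℚ-mono k x≤y)

toℚᵘ-/1 : ∀ k → ℚ.toℚᵘ ((+ k) / 1) ℚᵘ.≃ ℚᵘ.mkℚᵘ (+ k) 0
toℚᵘ-/1 k = ℚₚ.toℚᵘ-fromℚᵘ (ℚᵘ.mkℚᵘ (+ k) 0)

suc-/1 : ∀ k → (+ suc k) / 1 ≡ 1ℚ ℚ.+ (+ k) / 1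
suc-/1 k = ℚₚ.toℚᵘ-injective (let open ℚᵘₚ.≃-Reasoning in begin
  ℚ.toℚᵘ ((+ suc k) / 1)                ≈⟨ toℚᵘ-/1 (suc k) ⟩
  ℚᵘ.mkℚᵘ (+ suc k) 0                   ≈⟨ ℚᵘ.*≡* (cong (ℤ._* + 1) (cong (ℤ._+_ (+ 1)) (sym (ℤₚ.*-identityʳ (+ k))))) ⟩
  ℚᵘ.1ℚᵘ ℚᵘ.+ ℚᵘ.mkℚᵘ (+ k) 0           ≈⟨ ℚᵘₚ.+-congʳ ℚᵘ.1ℚᵘ (toℚᵘ-/1 k) ⟨
  ℚᵘ.1ℚᵘ ℚᵘ.+ ℚ.toℚᵘ ((+ k) / 1)        ≈⟨ ℚₚ.toℚᵘ-homo-+ 1ℚ ((+ k) / 1) ⟨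
  ℚ.toℚᵘ (1ℚ ℚ.+ (+ k) / 1)             ∎)

×ℚ≡/1* : ∀ k x → k ×ℚ x ≡ ((+ k) / 1) ℚ.* x
×ℚ≡/1* zero    x = sym (ℚₚ.*-zeroˡ x)
×ℚ≡/1* (suc k) x = let open ≡-Reasoning in begin
  x ℚ.+ k ×ℚ x                          ≡⟨ cong₂ ℚ._+_ (sym (ℚₚ.*-identityˡ x)) (×ℚ≡/1* k x) ⟩
  1ℚ ℚ.* x ℚ.+ ((+ k) / 1) ℚ.* x        ≡⟨ ℚₚ.*-distribʳ-+ x 1ℚ ((+ k) / 1) ⟨
  (1ℚ ℚ.+ (+ k) / 1) ℚ.* x              ≡⟨ cong (ℚ._* x) (suc-/1 k) ⟨
  ((+ suc k) / 1) ℚ.* x                 ∎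

archimedean : ∀ {δ} → 0ℚ ℚ.< δ → ∀ C → ∃[ j ] C ℚ.< suc j ×ℚ δ
archimedean {ℚ.mkℚ (ℤ.-[1+ _ ]) _ _} (ℚ.*<* ())
archimedean {ℚ.mkℚ (+ zero)     _ _} (ℚ.*<* (ℤ.+<+ ()))
archimedean {δ@(ℚ.mkℚ (+ suc e) d-1 _)} _ C@(ℚ.mkℚ i f-1 _) =
  j , ℚₚ.toℚᵘ-cancel-< (ℚᵘₚ.<-respʳ-≃ (ℚᵘₚ.≃-sym value) (ℚᵘ.*<* below))
  where
  j : ℕ
  j = ℤ.∣ i ∣ ℕ.* suc d-1
  value : ℚ.toℚᵘ (suc j ×ℚ δ) ℚᵘ.≃ ℚᵘ.mkℚᵘ (+ suc j) 0 ℚᵘ.* ℚ.toℚᵘ δ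
  value = ℚᵘₚ.≃-trans (ℚₚ.toℚᵘ-cong (×ℚ≡/1* (suc j) δ))
    (ℚᵘₚ.≃-trans (ℚₚ.toℚᵘ-homo-* ((+ suc j) / 1) δ) (ℚᵘₚ.*-congʳ (toℚᵘ-/1 (suc j))))
  below : i ℤ.* + (1 ℕ.* suc d-1) ℤ.< (+ suc j ℤ.* + suc e) ℤ.* + suc f-1
  below = let open ℤₚ.≤-Reasoning in begin-strict
    i ℤ.* + (1 ℕ.* suc d-1)                  ≡⟨ cong (λ k → i ℤ.* + k) (ℕₚ.*-identityˡ (suc d-1)) ⟩
    i ℤ.* + suc d-1                          ≤⟨ ℤₚ.*-monoʳ-≤-nonNeg (+ suc d-1) (i≤∣i∣ i) ⟩
    + ℤ.∣ i ∣ ℤ.* + suc d-1                  ≡⟨ ℤₚ.pos-* ℤ.∣ i ∣ (suc d-1) ⟨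
    + j                                      <⟨ ℤ.+<+ (ℕₚ.n<1+n j) ⟩
    + suc j                                  ≤⟨ ℤ.+≤+ (ℕₚ.≤-trans (ℕₚ.m≤m*n (suc j) (suc e)) (ℕₚ.m≤m*n (suc j ℕ.* suc e) (suc f-1))) ⟩
    + (suc j ℕ.* suc e ℕ.* suc f-1)          ≡⟨ ℤₚ.pos-* (suc j ℕ.* suc e) (suc f-1) ⟩
    + (suc j ℕ.* suc e) ℤ.* + suc f-1        ≡⟨ cong (ℤ._* + suc f-1) (ℤₚ.pos-* (suc j) (suc e)) ⟩
    (+ suc j ℤ.* + suc e) ℤ.* + suc f-1      ∎
    where
    i≤∣i∣ : ∀ i → i ℤ.≤ + ℤ.∣ i ∣
    i≤∣i∣ (+ n)       = ℤₚ.≤-refl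
    i≤∣i∣ ℤ.-[1+ n ]  = ℤ.-≤+

recip-* : ∀ m n .{{_ : ℕ.NonZero m}} .{{_ : ℕ.NonZero n}} .{{_ : ℕ.NonZero (m ℕ.* n)}} →
  (+ 1) / (m ℕ.* n) ≡ ((+ 1) / m) ℚ.* ((+ 1) / n)
recip-* m@(suc m-1) n@(suc n-1) = ℚₚ.toℚᵘ-injective (let open ℚᵘₚ.≃-Reasoning in begin
  ℚ.toℚᵘ ((+ 1) / (m ℕ.* n))                       ≈⟨ ℚₚ.toℚᵘ-fromℚᵘ (ℚᵘ.mkℚᵘ (+ 1) (n-1 ℕ.+ m-1 ℕ.* n)) ⟩
  ℚᵘ.mkℚᵘ (+ 1) m-1 ℚᵘ.* ℚᵘ.mkℚᵘ (+ 1) n-1         ≈⟨ ℚᵘₚ.*-cong (ℚₚ.toℚᵘ-fromℚᵘ (ℚᵘ.mkℚᵘ (+ 1) m-1))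
                                                                (ℚₚ.toℚᵘ-fromℚᵘ (ℚᵘ.mkℚᵘ (+ 1) n-1)) ⟨
  ℚ.toℚᵘ ((+ 1) / m) ℚᵘ.* ℚ.toℚᵘ ((+ 1) / n)       ≈⟨ ℚₚ.toℚᵘ-homo-* ((+ 1) / m) ((+ 1) / n) ⟨
  ℚ.toℚᵘ (((+ 1) / m) ℚ.* ((+ 1) / n))             ∎)

expTerm-suc : ∀ q k → expTerm q (suc k) ≡ (q ℚ.* ((+ 1) / suc k)) ℚ.* expTerm q k
expTerm-suc q k =
  trans (cong (q ℚ.* q ^ℚ k ℚ.*_) (recip-* (suc k) (k !) {{_}} {{k ℕₚ.!≢0}} {{suc k ℕₚ.!≢0}}))
        (regroup q (q ^ℚ k) ((+ 1) / suc k) (_/_ (+ 1) (k !) {{k ℕₚ.!≢0}}))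
  where
  regroup : ∀ a b c d → (a ℚ.* b) ℚ.* (c ℚ.* d) ≡ (a ℚ.* c) ℚ.* (b ℚ.* d)
  regroup = solve-∀ ℚ-ring

threshold : ℚ → ℕ
threshold q = ℤ.∣ ℚ.↥ q ∣ ℕ.* 2

ratio≤½ : ∀ q k → threshold q ℕ.≤ k → ∣ q ℚ.* ((+ 1) / suc k) ∣ ℚ.≤ ½
ratio≤½ q@(ℚ.mkℚ i d-1 _) k K≤k = ℚₚ.toℚᵘ-cancel-≤ (let open ℚᵘₚ.≤-Reasoning in begin
  ℚ.toℚᵘ ∣ q ℚ.* ((+ 1) / suc k) ∣                 ≃⟨ ℚₚ.toℚᵘ-homo-∣-∣ (q ℚ.* ((+ 1) / suc k)) ⟩
  ℚᵘ.∣ ℚ.toℚᵘ (q ℚ.* ((+ 1) / suc k)) ∣            ≃⟨ ℚᵘₚ.∣-∣-cong (ℚₚ.toℚᵘ-homo-* q ((+ 1) / suc k)) ⟩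
  ℚᵘ.∣ ℚ.toℚᵘ q ℚᵘ.* ℚ.toℚᵘ ((+ 1) / suc k) ∣      ≃⟨ ℚᵘₚ.∣-∣-cong (ℚᵘₚ.*-congˡ {ℚ.toℚᵘ q} (ℚₚ.toℚᵘ-fromℚᵘ (ℚᵘ.mkℚᵘ (+ 1) k))) ⟩
  ℚᵘ.∣ ℚ.toℚᵘ q ℚᵘ.* ℚᵘ.mkℚᵘ (+ 1) k ∣             ≃⟨ ℚᵘₚ.∣p*q∣≃∣p∣*∣q∣ (ℚ.toℚᵘ q) (ℚᵘ.mkℚᵘ (+ 1) k) ⟩
  ℚᵘ.mkℚᵘ (+ ℤ.∣ i ∣) d-1 ℚᵘ.* ℚᵘ.mkℚᵘ (+ 1) k     ≤⟨ ℚᵘ.*≤* (subst₂ ℤ._≤_ lhs rhs (ℤ.+≤+ bound)) ⟩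
  ℚᵘ.½                                             ∎)
  where
  bound : ℤ.∣ i ∣ ℕ.* 2 ℕ.≤ suc d-1 ℕ.* suc k
  bound = ℕₚ.≤-trans K≤k (ℕₚ.≤-trans (ℕₚ.n≤1+n k) (ℕₚ.m≤n*m (suc k) (suc d-1)))
  lhs : + (ℤ.∣ i ∣ ℕ.* 2) ≡ (+ ℤ.∣ i ∣ ℤ.* + 1) ℤ.* + 2
  lhs = trans (ℤₚ.pos-* ℤ.∣ i ∣ 2) (cong (ℤ._* + 2) (sym (ℤₚ.*-identityʳ (+ ℤ.∣ i ∣))))
  rhs : + (suc d-1 ℕ.* suc k) ≡ + 1 ℤ.* + (suc d-1 ℕ.* suc k)
  rhs = sym (ℤₚ.*-identityˡ (+ (suc d-1 ℕ.* suc k)))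

½-scaled : ∀ {r x} → ∣ r ∣ ℚ.≤ ½ → ∣ r ℚ.* x ∣ ℚ.+ ∣ r ℚ.* x ∣ ℚ.≤ ∣ x ∣
½-scaled {r} {x} r≤½ = let open ℚₚ.≤-Reasoning in begin
  ∣ r ℚ.* x ∣ ℚ.+ ∣ r ℚ.* x ∣        ≤⟨ ℚₚ.+-mono-≤ le le ⟩
  ½ ℚ.* ∣ x ∣ ℚ.+ ½ ℚ.* ∣ x ∣        ≡⟨ half+half ∣ x ∣ ⟩
  ∣ x ∣                              ∎
  where
  le : ∣ r ℚ.* x ∣ ℚ.≤ ½ ℚ.* ∣ x ∣
  le = subst (ℚ._≤ ½ ℚ.* ∣ x ∣) (sym (ℚₚ.∣p*q∣≡∣p∣*∣q∣ r x))
         (ℚₚ.*-monoʳ-≤-nonNeg ∣ x ∣ {{ℚₚ.∣-∣-nonNeg x}} r≤½)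

expTerm-halves : ∀ q k → threshold q ℕ.≤ k →
  ∣ expTerm q (suc k) ∣ ℚ.+ ∣ expTerm q (suc k) ∣ ℚ.≤ ∣ expTerm q k ∣
expTerm-halves q k K≤k =
  subst (λ x → ∣ x ∣ ℚ.+ ∣ x ∣ ℚ.≤ ∣ expTerm q k ∣) (sym (expTerm-suc q k))
    (½-scaled {q ℚ.* ((+ 1) / suc k)} {expTerm q k} (ratio≤½ q k K≤k))

p≤p+∣q∣ : ∀ p q → p ℚ.≤ p ℚ.+ ∣ q ∣
p≤p+∣q∣ p q = subst (ℚ._≤ p ℚ.+ ∣ q ∣) (ℚₚ.+-identityʳ p) (ℚₚ.+-monoʳ-≤ p (ℚₚ.0≤∣p∣ q))

-- A series whose terms eventually halve at each step has Cauchy partial sums.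
module _ (S t : ℕ → ℚ) (S-suc : ∀ n → S (suc n) ≡ S n ℚ.+ t n)
         (K : ℕ) (halves : ∀ k → K ℕ.≤ k → ∣ t (suc k) ∣ ℚ.+ ∣ t (suc k) ∣ ℚ.≤ ∣ t k ∣) where

  halving-tail : ∀ n → K ℕ.≤ n → ∀ j →
    ∣ S (j ℕ.+ n) ℚ.- S n ∣ ℚ.+ (∣ t (j ℕ.+ n) ∣ ℚ.+ ∣ t (j ℕ.+ n) ∣) ℚ.≤ ∣ t n ∣ ℚ.+ ∣ t n ∣
  halving-tail n K≤n zero = ℚₚ.≤-reflexive
    (trans (cong (λ x → ∣ x ∣ ℚ.+ (∣ t n ∣ ℚ.+ ∣ t n ∣)) (ℚₚ.+-inverseʳ (S n))) (ℚₚ.+-identityˡ _))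
  halving-tail n K≤n (suc j) = step {S (suc j ℕ.+ n)} {S (j ℕ.+ n)} {S n} {t (suc j ℕ.+ n)} {t (j ℕ.+ n)}
      (S-suc (j ℕ.+ n)) (halves (j ℕ.+ n) (ℕₚ.≤-trans K≤n (ℕₚ.m≤n+m n j))) (halving-tail n K≤n j)
    where
    shift : ∀ a b c → (a ℚ.+ b) ℚ.- c ≡ (a ℚ.- c) ℚ.+ b
    shift = solve-∀ ℚ-ring
    step : ∀ {S″ S′ S₀ t″ t′ b} → S″ ≡ S′ ℚ.+ t′ → ∣ t″ ∣ ℚ.+ ∣ t″ ∣ ℚ.≤ ∣ t′ ∣ →
      ∣ S′ ℚ.- S₀ ∣ ℚ.+ (∣ t′ ∣ ℚ.+ ∣ t′ ∣) ℚ.≤ b →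
      ∣ S″ ℚ.- S₀ ∣ ℚ.+ (∣ t″ ∣ ℚ.+ ∣ t″ ∣) ℚ.≤ b
    step {S″} {S′} {S₀} {t″} {t′} {b} eq h ih = let open ℚₚ.≤-Reasoning in begin
      ∣ S″ ℚ.- S₀ ∣ ℚ.+ (∣ t″ ∣ ℚ.+ ∣ t″ ∣)             ≤⟨ ℚₚ.+-monoʳ-≤ ∣ S″ ℚ.- S₀ ∣ h ⟩
      ∣ S″ ℚ.- S₀ ∣ ℚ.+ ∣ t′ ∣                          ≡⟨ cong (λ x → ∣ x ∣ ℚ.+ ∣ t′ ∣) (trans (cong (ℚ._- S₀) eq) (shift S′ t′ S₀)) ⟩
      ∣ (S′ ℚ.- S₀) ℚ.+ t′ ∣ ℚ.+ ∣ t′ ∣                 ≤⟨ ℚₚ.+-monoˡ-≤ ∣ t′ ∣ (ℚₚ.∣p+q∣≤∣p∣+∣q∣ (S′ ℚ.- S₀) t′) ⟩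
      (∣ S′ ℚ.- S₀ ∣ ℚ.+ ∣ t′ ∣) ℚ.+ ∣ t′ ∣             ≡⟨ ℚₚ.+-assoc (∣ S′ ℚ.- S₀ ∣) (∣ t′ ∣) (∣ t′ ∣) ⟩
      ∣ S′ ℚ.- S₀ ∣ ℚ.+ (∣ t′ ∣ ℚ.+ ∣ t′ ∣)             ≤⟨ ih ⟩
      b                                                 ∎

  tail-bound : ∀ n m → K ℕ.≤ n → n ℕ.≤ m → ∣ S m ℚ.- S n ∣ ℚ.≤ ∣ t n ∣ ℚ.+ ∣ t n ∣
  tail-bound n m K≤n n≤m = subst (λ k → ∣ S k ℚ.- S n ∣ ℚ.≤ ∣ t n ∣ ℚ.+ ∣ t n ∣) (ℕₚ.m∸n+n≡m n≤m)
    (ℚₚ.≤-trans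
      (ℚₚ.≤-trans (p≤p+∣q∣ _ (t (m ∸ n ℕ.+ n))) (ℚₚ.+-monoʳ-≤ ∣ S (m ∸ n ℕ.+ n) ℚ.- S n ∣ (p≤p+∣q∣ ∣ t (m ∸ n ℕ.+ n) ∣ (t (m ∸ n ℕ.+ n)))))
      (halving-tail n K≤n (m ∸ n)))

  decay : ∀ j → suc j ×ℚ ∣ t (j ℕ.+ K) ∣ ℚ.≤ ∣ t K ∣
  decay zero    = ℚₚ.≤-reflexive (ℚₚ.+-identityʳ ∣ t K ∣)
  decay (suc j) = ℚₚ.≤-trans
    (step {∣ t (suc j ℕ.+ K) ∣} {∣ t (j ℕ.+ K) ∣} (p≤p+∣q∣ _ _) (halves (j ℕ.+ K) (ℕₚ.m≤n+m K j))) (decay j)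
    where
    step : ∀ {x y} → x ℚ.≤ x ℚ.+ x → x ℚ.+ x ℚ.≤ y → suc (suc j) ×ℚ x ℚ.≤ suc j ×ℚ y
    step {x} {y} x≤2x 2x≤y = subst (ℚ._≤ suc j ×ℚ y) (ℚₚ.+-assoc x x (j ×ℚ x))
      (ℚₚ.+-mono-≤ 2x≤y (×ℚ-mono j (ℚₚ.≤-trans x≤2x 2x≤y)))

  geometric-cauchy : IsCauchy S
  geometric-cauchy ε 0<ε = N , close
    where
    δ : ℚ
    δ = ½ ℚ.* (½ ℚ.* ε)
    0<δ : 0ℚ ℚ.< δ
    0<δ = half-pos (half-pos 0<ε)
    j : ℕ
    j = proj₁ (archimedean 0<δ ∣ t K ∣)
    N : ℕ
    N = j ℕ.+ K
    K≤N : K ℕ.≤ N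
    K≤N = ℕₚ.m≤n+m K j
    tN<δ : ∣ t N ∣ ℚ.< δ
    tN<δ = ℚₚ.≰⇒> λ δ≤tN → ℚₚ.<-irrefl refl
      (ℚₚ.<-≤-trans (proj₂ (archimedean 0<δ ∣ t K ∣)) (ℚₚ.≤-trans (×ℚ-mono (suc j) δ≤tN) (decay j)))
    near : ∀ n → N ℕ.≤ n → ∣ S n ℚ.- S N ∣ ℚ.< ½ ℚ.* ε
    near n N≤n = subst (∣ S n ℚ.- S N ∣ ℚ.<_) (half+half (½ ℚ.* ε))
      (ℚₚ.≤-<-trans (tail-bound N n K≤N N≤n) (ℚₚ.+-mono-< tN<δ tN<δ))
    detour : ∀ a b c → a ℚ.- b ≡ (a ℚ.- c) ℚ.- (b ℚ.- c)
    detour = solve-∀ ℚ-ring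
    close : ∀ m n → N ℕ.≤ m → N ℕ.≤ n → ∣ S m ℚ.- S n ∣ ℚ.< ε
    close m n N≤m N≤n = subst₂ ℚ._<_ (cong ∣_∣ (sym (detour (S m) (S n) (S N)))) (half+half ε)
      (ℚₚ.≤-<-trans (ℚₚ.∣p-q∣≤∣p∣+∣q∣ (S m ℚ.- S N) (S n ℚ.- S N))
        (ℚₚ.+-mono-< (near m N≤m) (near n N≤n)))

exp : ℚ → ℝ
exp q = mkℝ (expPartialSum q)
  (geometric-cauchy (expPartialSum q) (expTerm q) (λ _ → refl) (threshold q) (expTerm-halves q))

record Graph (n : ℕ) : Set₁ where
  infix 4 _~_ _~?_
  field
    _~_       : Rel (Fin n) 0ℓ
    _~?_      : Decidable _~_
    ~-sym     : Symmetric _~_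
    ~-irrefl  : Irreflexive _≡_ _~_
    connected : ∀ u v → Star _~_ u v
    hasEdge   : ∃₂ λ u v → u ~ v

  degree : Fin n → ℕ
  degree u = length (filter (u ~?_) (allFin n))

  -- Each edge is listed once, as (u , v) with u < v.
  edges : List (Fin n × Fin n)
  edges = filter (λ (u , v) → (u Finₚ.<? v) ×-dec (u ~? v)) (cartesianProduct (allFin n) (allFin n))

  -- The cycle v₀ v₁ ⋯ vₖ v₀; the last conjunct of closed is vₖ ~ v₀.
  record Cycle : Set where
    field
      base     : Fin n
      others   : List (Fin n)
      distinct : Unique (base ∷ others)
      long     : 2 ℕ.≤ length others
      closed   : Linked _~_ (base ∷ others ++ base ∷ [])

    Uses : Rel (Fin n) 0ℓ
    Uses u v = (u , v) ∈ steps ⊎ (v , u) ∈ steps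
      where
      steps : List (Fin n × Fin n)
      steps = zip (base ∷ others) (others ++ base ∷ [])

  -- A cycle is a subgraph, so vertex listings that differ by rotation or
  -- reversal, i.e. that use the same edges, are the same cycle.
  SameCycle : Rel Cycle 0ℓ
  SameCycle C D = ∀ u v → Cycle.Uses C u v ⇔ Cycle.Uses D u v

open Graph public using (degree; edges)

Unicyclic : ∀ {n} → Pred (Graph n) 0ℓ
Unicyclic G = Σ Cycle λ C → ∀ D → SameCycle C D
  where open Graph G

maxDegree : ∀ {n} → Graph n → ℕ
maxDegree {n} G = max 0 (map (degree G) (allFin n))

≥-decTotalOrder : DecTotalOrder 0ℓ 0ℓ 0ℓ
≥-decTotalOrder = Flip.decTotalOrder ℕₚ.≤-decTotalOrder

degreeSequence : ∀ {n} → Graph n → List ℕ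
degreeSequence {n} G = sort (map (degree G) (allFin n))
  where open Sort ≥-decTotalOrder

SEI : ∀ {n} → ℝ → Graph n → ℝ
SEI a G = ∑ (map (λ (u , v) → a ^ degree G u +ℝ a ^ degree G v) (edges G))

-- For 3 ≤ Δ ≤ n - 1 no subtraction below is truncated and 𝐳 has length n.
module _ (n Δ : ℕ) (3≤Δ : 3 ℕ.≤ Δ) where

  quotient : ℕ
  quotient = ℕ._/_ n (Δ ∸ 1) {{ℕ.>-nonZero (ℕₚ.m<n⇒0<n∸m (ℕₚ.≤-trans (ℕₚ.n≤1+n 2) 3≤Δ))}}

  𝐳 : List ℕ
  𝐳 = if does ((quotient ℕₚ.≟ 1) ⊎-dec (n ℕₚ.≟ 2 ℕ.* Δ ∸ 2))
      then Δ ∷ n ∸ Δ ℕ.+ 1 ∷ 2 ∷ replicate (n ∸ 3) 1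
      else replicate quotient Δ ++ (n ∸ quotient ℕ.* (Δ ∸ 1)) ℕ.+ 1 ∷ replicate (n ∸ quotient ∸ 1) 1

  𝓚 : Pred (Graph n) 0ℓ
  𝓚 G = Unicyclic G × degreeSequence G ≡ 𝐳

{-# OPTIONS --safe #-}

-- Orient the cycle cyclically and every other vertex towards the cycle. Every vertex gets
-- exactly one outgoing edge, and an edge not of the form v — s v would close a second cycle,
-- so degree u = 1 + indegree u and the indegrees x sum to n. By the handshake identity
-- SEI_a(G) = Σ h(x) with h(k) = (k + 1) a^(k+1), whose second difference
-- a^(k+1) (a - 1) ((k + 3) a - (k + 1)) is positive for a > 1 and for a < 1/3, hence for
-- a ≤ e⁻². Replacing two entries x, y by u ≥ x, y ≥ v with u + v = x + y therefore strictly
-- increases the sum unless nothing changes. If the largest entry is kept, such moves lead to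
-- (Δ - 1, n - Δ, 1, 0, …), because three entries are nonzero; if only the bound Δ - 1 on the
-- entries is kept, they lead to (Δ - 1, …, Δ - 1, r, 0, …).

module Submission where

open import Defs
open import Level using (0ℓ)
open import Algebra.Bundles using (CommutativeMonoid)
import Algebra.Definitions.RawMonoid as RawMonoidDefinitions
import Algebra.Properties.CommutativeSemigroup as CommutativeSemigroupProperties
open import Data.Bool.Base using (if_then_else_)
open import Data.Fin.Base as Fin using (Fin)
import Data.Fin.Properties as Finₚ
open import Data.Integer.Base as ℤ using (-[1+_])
open import Data.List.Base
  using (List; []; _∷_; _++_; map; zip; length; filter; replicate; allFin; cartesianProduct)
import Data.List.Extrema.Nat as Extrema
open import Data.List.Membership.Propositional using (_∈_; _∉_)
import Data.List.Membership.DecPropositional as DecMembership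
open import Data.List.Membership.Propositional.Properties
  using (∈-allFin; ∈-∃++; ∈-filter⁺; ∈-length; ∈-map⁻)
open import Data.List.Properties
  using (map-∘; map-cong; map-id; map-++; map-replicate; length-map; length-tabulate)
open import Data.List.Relation.Binary.Permutation.Propositional as ↭
  using (_↭_; ↭-refl; ↭-sym; ↭-trans; ↭-prep; ↭-reflexive; ↭⇒↭ₛ)
open import Data.List.Relation.Binary.Permutation.Propositional.Properties
  using (shift; map⁺; drop-∷; ↭-length)
open import Data.List.Relation.Binary.Pointwise using (Pointwise-≡⇒≡)
open import Data.List.Relation.Unary.All as All using (All; []; _∷_)
import Data.List.Relation.Unary.All.Properties as Allₚ
open import Data.List.Relation.Unary.AllPairs using ([]; _∷_)
open import Data.List.Relation.Unary.Any using (here; there)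
import Data.List.Relation.Unary.Any.Properties as Anyₚ
open import Data.List.Relation.Unary.Linked using (Linked; []; [-]; _∷_)
open import Data.List.Relation.Unary.Sorted.TotalOrder.Properties using (↗↭↗⇒≋)
open import Data.List.Relation.Unary.Unique.Propositional using (Unique)
open import Data.List.Relation.Unary.Unique.Propositional.Properties using (allFin⁺)
import Data.List.Sort as Sort
open import Data.Nat.Base
  using (ℕ; zero; suc; pred; NonZero; >-nonZero; _+_; _*_; _∸_; _⊔_; _≤_; _<_; z≤n; s≤s; s≤s⁻¹)
open import Data.Nat.Divisibility using (divides-refl)
import Data.Nat.DivMod as ℕ
open import Data.Nat.Induction using (<-wellFounded)
open import Data.Nat.ListAction using (sum)
open import Data.Nat.ListAction.Properties using (sum-↭)
import Data.Nat.Properties as ℕₚ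
open import Data.Product.Base using (∃; ∃-syntax; _×_; _,_; proj₁; proj₂; uncurry)
open import Data.Rational.Base as ℚ using (ℚ; 0ℚ; 1ℚ; _/_)
import Data.Rational.Properties as ℚₚ
open import Data.Sum.Base as Sum using (_⊎_; inj₁; inj₂; [_,_]′)
open import Function.Base using (_∘_; id)
open import Function.Bundles using (_⇔_; mk⇔; module Equivalence)
open import Induction.WellFounded using (Acc; acc)
open import Relation.Binary.Bundles using (DecTotalOrder)
open import Relation.Binary.Construct.Closure.ReflexiveTransitive as Star using (Star; _◅_; _◅◅_; reverse; gmap)
open import Relation.Binary.Core using (Rel)
open import Relation.Binary.Definitions using (DecidableEquality; tri<; tri≈; tri>)
open import Relation.Binary.PropositionalEquality
  using (_≡_; _≢_; refl; sym; trans; cong; cong₂; subst; subst₂; module ≡-Reasoning)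
open import Relation.Nullary using (¬_; Dec; yes; no; does; contradiction)
open import Relation.Nullary.Decidable
  using (decidable-stable; dec⇒maybe; dec-true; dec-false; toWitness; _×-dec_; _⊎-dec_)
open import Relation.Unary using (Pred; Decidable)
open import Tactic.RingSolver using (solve-∀)
import Tactic.RingSolver.Core.AlmostCommutativeRing as ACR

open CommutativeSemigroupProperties ℕₚ.+-commutativeSemigroup using (x∙yz≈y∙xz; xy∙z≈xz∙y)

-- Cycles and orientations

-- zip (x ∷ xs) (xs ++ b ∷ []) lists the consecutive pairs of x ∷ xs ++ b ∷ [].

module _ {A : Set} {b : A} where

  zip-linked⁺ : ∀ {R : Rel A 0ℓ} x xs → Linked R (x ∷ xs ++ b ∷ []) → All (uncurry R) (zip (x ∷ xs) (xs ++ b ∷ []))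
  zip-linked⁺ x []       (r ∷ [-]) = r ∷ []
  zip-linked⁺ x (y ∷ xs) (r ∷ rs)  = r ∷ zip-linked⁺ y xs rs

  zip-linked⁻ : ∀ {R : Rel A 0ℓ} x xs → All (uncurry R) (zip (x ∷ xs) (xs ++ b ∷ [])) → Linked R (x ∷ xs ++ b ∷ [])
  zip-linked⁻ x []       (r ∷ []) = r ∷ [-]
  zip-linked⁻ x (y ∷ xs) (r ∷ rs) = r ∷ zip-linked⁻ y xs rs

  zip-source : ∀ x xs {u v} → (u , v) ∈ zip (x ∷ xs) (xs ++ b ∷ []) → u ∈ x ∷ xs
  zip-source x []       (here refl) = here refl
  zip-source x (y ∷ xs) (here refl) = here refl
  zip-source x (y ∷ xs) (there p)   = there (zip-source y xs p)

  zip-target : ∀ x xs {u v} → (u , v) ∈ zip (x ∷ xs) (xs ++ b ∷ []) → v ∈ xs ⊎ v ≡ b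
  zip-target x []       (here refl) = inj₂ refl
  zip-target x (y ∷ xs) (here refl) = inj₁ (here refl)
  zip-target x (y ∷ xs) (there p) with zip-target y xs p
  ... | inj₁ v∈xs = inj₁ (there v∈xs)
  ... | inj₂ v≡b  = inj₂ v≡b

  zip-next : ∀ x xs {u} → u ∈ x ∷ xs → ∃[ v ] (u , v) ∈ zip (x ∷ xs) (xs ++ b ∷ [])
  zip-next x []       (here refl) = b , here refl
  zip-next x (y ∷ xs) (here refl) = y , here refl
  zip-next x (y ∷ xs) (there p) with zip-next y xs p
  ... | v , q = v , there q

  zip-functional : ∀ x xs {u v w} → Unique (x ∷ xs) →
    (u , v) ∈ zip (x ∷ xs) (xs ++ b ∷ []) → (u , w) ∈ zip (x ∷ xs) (xs ++ b ∷ []) → v ≡ w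
  zip-functional x []       _            (here refl) (here refl) = refl
  zip-functional x (y ∷ xs) _            (here refl) (here refl) = refl
  zip-functional x (y ∷ xs) (x∉ ∷ _)     (here refl) (there q)   = contradiction (zip-source y xs q) (Allₚ.All¬⇒¬Any x∉)
  zip-functional x (y ∷ xs) (x∉ ∷ _)     (there p)   (here refl) = contradiction (zip-source y xs p) (Allₚ.All¬⇒¬Any x∉)
  zip-functional x (y ∷ xs) (_ ∷ unique) (there p)   (there q)   = zip-functional y xs unique p q

  linked-star : ∀ {R : Rel A 0ℓ} x xs {u} → Linked R (x ∷ xs ++ b ∷ []) → u ∈ x ∷ xs → Star R u b
  linked-star x []       (r ∷ [-]) (here refl) = r ◅ Star.ε
  linked-star x (y ∷ xs) (r ∷ rs)  (here refl) = r ◅ linked-star y xs rs (here refl)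
  linked-star x (y ∷ xs) (r ∷ rs)  (there p)   = linked-star y xs rs p

-- The second successor of `b` is the third listed vertex; `long` in a cycle guarantees that it
-- exists, and distinctness separates it from `b`.
second-differs : ∀ {A : Set} {s : A → A} {b} xs → Unique (b ∷ xs) → 2 ≤ length xs →
  Linked (λ u v → s u ≡ v) (b ∷ xs ++ b ∷ []) → s (s b) ≢ b
second-differs (_ ∷ [])    _                   (s≤s ()) _
second-differs (_ ∷ _ ∷ _) ((_ ∷ b≢y ∷ _) ∷ _) _        (refl ∷ refl ∷ _) s²b≡b = b≢y (sym s²b≡b)

module _ {A : Set} (_≟_ : DecidableEquality A) {R : Rel A 0ℓ} where
  open DecMembership _≟_ using (_∈?_)

  -- A path u ⟶ v without repeated vertices; the index lists the vertices after u.
  data Path : A → A → List A → Set where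
    []  : ∀ {v} → Path v v []
    _∷_ : ∀ {u w v ws} → R u w × u ∉ w ∷ ws → Path w v ws → Path u v (w ∷ ws)

  path-suffix : ∀ {u v w ws} → Path w v ws → u ∈ w ∷ ws → ∃[ us ] Path u v us
  path-suffix p       (here refl) = _ , p
  path-suffix (_ ∷ p) (there u∈)  = path-suffix p u∈

  -- Loop erasure: if `u` already lies on the path built from `w`, that path is cut back to its part
  -- from `u` on.
  star-path : ∀ {u v} → Star R u v → ∃[ ws ] Path u v ws
  star-path Star.ε = [] , []
  star-path {u} (_◅_ {j = w} r rs) with star-path rs
  ... | ws , p with u ∈? w ∷ ws
  ...   | yes u∈ = path-suffix p u∈
  ...   | no u∉  = w ∷ ws , (r , u∉) ∷ p

  path-unique : ∀ {u v ws} → Path u v ws → Unique (u ∷ ws)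
  path-unique []             = [] ∷ []
  path-unique ((_ , u∉) ∷ p) = Allₚ.¬Any⇒All¬ _ u∉ ∷ path-unique p

  path-closed : ∀ {S : Rel A 0ℓ} → (∀ {x y} → R x y → S x y) →
    ∀ {u v b ws} → Path u v ws → S v b → Linked S (u ∷ ws ++ b ∷ [])
  path-closed f []            s = s ∷ [-]
  path-closed f ((r , _) ∷ p) s = f r ∷ path-closed f p s

  path-last : ∀ {u v b ws} → Path u v ws → (v , b) ∈ zip (u ∷ ws) (ws ++ b ∷ [])
  path-last []      = here refl
  path-last (_ ∷ p) = there (path-last p)

least : ∀ {P : Pred ℕ 0ℓ} → Decidable P → ∀ k → P k → ∃[ m ] P m × ∀ j → P j → m ≤ j
least P? k p with P? 0
... | yes p₀ = 0 , p₀ , λ _ _ → z≤n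
least P? zero    p | no ¬p₀ = contradiction p ¬p₀
least {P} P? (suc k) p | no ¬p₀ with least {P ∘ suc} (P? ∘ suc) k p
... | m , pₘ , min = suc m , pₘ , λ where
  zero    p₀ → contradiction p₀ ¬p₀
  (suc j) pⱼ → s≤s (min j pⱼ)

-- s orients every edge of G so that each vertex has exactly one outgoing edge.
record IsOrientation {n : ℕ} (G : Graph n) (s : Fin n → Fin n) : Set where
  open Graph G
  field
    edge⇒   : ∀ {u v} → u ~ v → s u ≡ v ⊎ s v ≡ u
    forward : ∀ u → u ~ s u
    no-swap : ∀ u → s (s u) ≢ u

-- Orienting a unicyclic graph towards its cycle

module _ {n : ℕ} (G : Graph n) (unicyclic : Unicyclic G) where
  open Graph G
  open DecMembership (Finₚ._≟_ {n}) using (_∈?_)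

  private
    module C = Cycle (proj₁ unicyclic)

    onCycle : List (Fin n)
    onCycle = C.base ∷ C.others

    steps : List (Fin n × Fin n)
    steps = zip onCycle (C.others ++ C.base ∷ [])

    -- A walk of exactly `k` edges leads from `v` to the cycle. The least such `k` is the distance
    -- `dist v`.
    Within : ℕ → Pred (Fin n) 0ℓ
    Within zero    v = v ∈ onCycle
    Within (suc k) v = ∃[ u ] v ~ u × Within k u

    within? : ∀ k → Decidable (Within k)
    within? zero    v = v ∈? onCycle
    within? (suc k) v = Finₚ.any? λ u → (v ~? u) ×-dec within? k u

    within : ∀ {v} → Star _~_ v C.base → ∃[ k ] Within k v
    within Star.ε  = 0 , here refl
    within (e ◅ w) with within w
    ... | k , wₖ = suc k , _ , e , wₖ

    nearest : ∀ v → ∃[ k ] Within k v × ∀ j → Within j v → k ≤ j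
    nearest v with within (connected v C.base)
    ... | k , wₖ = least (λ j → within? j v) k wₖ

    dist : Fin n → ℕ
    dist v = proj₁ (nearest v)

    -- The two kinds of outgoing edge: along the cycle in its listed direction, or from a vertex off
    -- the cycle to one nearer to it.
    Closer : Fin n → Fin n → Set
    Closer v w = (v , w) ∈ steps ⊎ v ∉ onCycle × v ~ w × dist w < dist v

    approach : ∀ {v} k → v ∉ onCycle → Within k v → ∃[ w ] v ~ w × dist w < k
    approach zero    v∉ v∈           = contradiction v∈ v∉
    approach (suc k) v∉ (w , e , wₖ) = w , e , s≤s (proj₂ (proj₂ (nearest w)) k wₖ)

    closer : ∀ v → ∃ (Closer v)
    closer v = pick (v ∈? onCycle)
      where
      pick : Dec (v ∈ onCycle) → ∃ (Closer v)
      pick (yes v∈) with zip-next C.base C.others v∈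
      ... | w , p = w , inj₁ p
      pick (no v∉) with approach (dist v) v∉ (proj₁ (proj₂ (nearest v)))
      ... | w , e , lt = w , inj₂ (v∉ , e , lt)

    s : Fin n → Fin n
    s v = proj₁ (closer v)

    steps⇒~ : ∀ {u v} → (u , v) ∈ steps → u ~ v
    steps⇒~ = All.lookup (zip-linked⁺ C.base C.others C.closed)

    s-edge : ∀ v → v ~ s v
    s-edge v with proj₂ (closer v)
    ... | inj₁ p           = steps⇒~ p
    ... | inj₂ (_ , e , _) = e

    -- A source of a step lies on the cycle, which rules out the second kind of outgoing edge;
    -- distinctness then leaves a single step from that source.
    s-step : ∀ {u v} → (u , v) ∈ steps → s u ≡ v
    s-step {u} p with proj₂ (closer u)
    ... | inj₁ q        = zip-functional C.base C.others C.distinct q p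
    ... | inj₂ (u∉ , _) = contradiction (zip-source C.base C.others p) u∉

    s-chain : Linked (λ u v → s u ≡ v) (onCycle ++ C.base ∷ [])
    s-chain = zip-linked⁻ C.base C.others (All.tabulate s-step)

    -- Off the cycle each application of `s` decreases the distance, so the cycle is reached; from
    -- there the rest of its listing leads to the base.
    iterates-to-base : ∀ v → Star (λ u w → s u ≡ w) v C.base
    iterates-to-base v = go v (<-wellFounded (dist v))
      where
      go : ∀ v → Acc _<_ (dist v) → Star (λ u w → s u ≡ w) v C.base
      go v (acc rs) with proj₂ (closer v)
      ... | inj₁ p            = linked-star C.base C.others s-chain (zip-source C.base C.others p)
      ... | inj₂ (_ , _ , lt) = refl ◅ go (s v) (rs lt)

    _≈ₛ_ : Rel (Fin n) 0ℓ
    u ≈ₛ v = s u ≡ v ⊎ s v ≡ u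

    ≈ₛ⇒~ : ∀ {u v} → u ≈ₛ v → u ~ v
    ≈ₛ⇒~ {u} (inj₁ refl) = s-edge u
    ≈ₛ⇒~ {v = v} (inj₂ refl) = ~-sym (s-edge v)

    ≈ₛ-connected : ∀ u v → Star _≈ₛ_ u v
    ≈ₛ-connected u v = to-base u ◅◅ reverse Sum.swap (to-base v)
      where
      to-base : ∀ u → Star _≈ₛ_ u C.base
      to-base u = gmap id inj₁ (iterates-to-base u)

    -- A missing edge would close a path of oriented edges to a second cycle.
    edge-oriented : ∀ {u v} → u ~ v → u ≈ₛ v
    edge-oriented {u} {v} e = decidable-stable ((s u Finₚ.≟ v) ⊎-dec (s v Finₚ.≟ u)) λ ¬o →
      ¬o (on-C (Equivalence.from (proj₂ unicyclic (second ¬o) v u) (inj₁ (path-last Finₚ._≟_ path))))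
      where
      vertices : List (Fin n)
      vertices = proj₁ (star-path Finₚ._≟_ (≈ₛ-connected u v))
      path : Path Finₚ._≟_ u v vertices
      path = proj₂ (star-path Finₚ._≟_ (≈ₛ-connected u v))
      -- A path with a single step would be the edge `u ~ v` itself, which is assumed not to be
      -- oriented.
      long : ∀ {ws} → ¬ (u ≈ₛ v) → Path Finₚ._≟_ u v ws → 2 ≤ length ws
      long ¬o []             = contradiction e (~-irrefl refl)
      long ¬o ((o , _) ∷ []) = contradiction o ¬o
      long ¬o (_ ∷ (_ ∷ _))  = s≤s (s≤s z≤n)
      second : ¬ (u ≈ₛ v) → Cycle
      second ¬o = record
        { base     = u
        ; others   = vertices
        ; distinct = path-unique Finₚ._≟_ path
        ; long     = long ¬o path
        ; closed   = path-closed Finₚ._≟_ ≈ₛ⇒~ path (~-sym e)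
        }
      -- Uniqueness makes the closing edge of the second cycle an edge of the given cycle, and `s`
      -- orients all of those.
      on-C : C.Uses v u → u ≈ₛ v
      on-C (inj₁ p) = inj₂ (s-step p)
      on-C (inj₂ p) = inj₁ (s-step p)

    s-onCycle : ∀ {v} → v ∈ onCycle → s v ∈ onCycle
    s-onCycle v∈ with zip-next C.base C.others v∈
    ... | w , p with zip-target C.base C.others p
    ...   | inj₁ w∈   = there (subst (_∈ C.others) (sym (s-step p)) w∈)
    ...   | inj₂ refl = here (s-step p)

    base≢s²base : s (s C.base) ≢ C.base
    base≢s²base = second-differs C.others C.distinct C.long s-chain

    -- If `s` swapped `v` and `s v`, the orbit of `v` would consist of these two. It contains the
    -- base, so the base would be fixed by `s` applied twice.
    s²v≢v-onCycle : ∀ {v} → v ∈ onCycle → s (s v) ≢ v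
    s²v≢v-onCycle {v} v∈ eq = no-base (orbit (iterates-to-base v) (inj₁ refl))
      where
      orbit : ∀ {u w} → Star (λ u w → s u ≡ w) u w → u ≡ v ⊎ u ≡ s v → w ≡ v ⊎ w ≡ s v
      orbit Star.ε     o           = o
      orbit (refl ◅ w) (inj₁ refl) = orbit w (inj₂ refl)
      orbit (refl ◅ w) (inj₂ refl) = orbit w (inj₁ eq)
      no-base : ¬ (C.base ≡ v ⊎ C.base ≡ s v)
      no-base (inj₁ b≡v)  = base≢s²base (subst (λ x → s (s x) ≡ x) (sym b≡v) eq)
      no-base (inj₂ b≡sv) = base≢s²base (subst (λ x → s (s x) ≡ x) (sym b≡sv) (cong s eq))

    -- For `v` off the cycle, a swap is impossible in both remaining cases: if `s v` is on the
    -- cycle, `s` never leaves it again; if not, the distance would decrease twice and yet return to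
    -- its value.
    s²v≢v : ∀ v → s (s v) ≢ v
    s²v≢v v eq = refute (proj₂ (closer v)) (proj₂ (closer (s v)))
      where
      refute : Closer v (s v) → ¬ Closer (s v) (s (s v))
      refute (inj₁ p) _ = s²v≢v-onCycle (zip-source C.base C.others p) eq
      refute (inj₂ (v∉ , _)) (inj₁ p) =
        v∉ (subst (_∈ onCycle) eq (s-onCycle (zip-source C.base C.others p)))
      refute (inj₂ (_ , _ , lt)) (inj₂ (_ , _ , lt′)) =
        ℕₚ.<-asym lt (subst (λ x → dist x < dist (s v)) eq lt′)

  orientation : ∃ (IsOrientation G)
  orientation = s , record { edge⇒ = edge-oriented ; forward = s-edge ; no-swap = s²v≢v }

-- Degrees and the handshake identity

-- The members of `ys` are moved to the front one after the other. Distinctness keeps the later ones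
-- in the remainder when an earlier one is taken out.
unique-extract : ∀ {A : Set} {xs : List A} ys → Unique ys → All (_∈ xs) ys → ∃[ rest ] xs ↭ ys ++ rest
unique-extract []       _             _            = _ , ↭-refl
unique-extract (y ∷ ys) (y∉ ∷ unique) (y∈ ∷ ys⊆xs) with ∈-∃++ y∈
... | as , bs , refl with unique-extract ys unique (All.zipWith remaining (y∉ , ys⊆xs))
  where
  remaining : ∀ {z} → y ≢ z × z ∈ as ++ y ∷ bs → z ∈ as ++ bs
  remaining (y≢z , z∈) with Anyₚ.++⁻ as z∈
  ... | inj₁ z∈as         = Anyₚ.++⁺ˡ z∈as
  ... | inj₂ (here z≡y)   = contradiction (sym z≡y) y≢z
  ... | inj₂ (there z∈bs) = Anyₚ.++⁺ʳ as z∈bs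
... | rest , p = rest , ↭-trans (shift y as bs) (↭-prep y p)

-- An arbitrary commutative monoid serves two uses: counting in the natural numbers, and summing
-- rational approximations of real terms.
module ListSum (M : CommutativeMonoid 0ℓ 0ℓ) where
  open CommutativeMonoid M renaming (refl to ≈-refl; sym to ≈-sym; trans to ≈-trans; ε to 0#)
  open import Algebra.Definitions.RawMonoid rawMonoid using () renaming (_×_ to _⊗_)
  open import Algebra.Properties.CommutativeSemigroup commutativeSemigroup using (interchange)
  open import Relation.Binary.Reasoning.Setoid setoid

  private variable
    A B : Set

  ∑[_]_ : List A → (A → Carrier) → Carrier
  ∑[ []     ] f = 0#
  ∑[ x ∷ xs ] f = f x ∙ (∑[ xs ] f)

  _when_ : ∀ {P : Set} → Carrier → Dec P → Carrier
  x when d = if does d then x else 0#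

  ∑-cong : ∀ (xs : List A) {f g} → (∀ x → f x ≈ g x) → ∑[ xs ] f ≈ ∑[ xs ] g
  ∑-cong []       eq = ≈-refl
  ∑-cong (x ∷ xs) eq = ∙-cong (eq x) (∑-cong xs eq)

  ∑-∙ : ∀ (xs : List A) f g → ∑[ xs ] (λ x → f x ∙ g x) ≈ (∑[ xs ] f) ∙ (∑[ xs ] g)
  ∑-∙ []       f g = ≈-sym (identityˡ 0#)
  ∑-∙ (x ∷ xs) f g = ≈-trans (∙-congˡ (∑-∙ xs f g)) (interchange _ _ _ _)

  ∑-++ : ∀ (xs ys : List A) f → ∑[ xs ++ ys ] f ≈ (∑[ xs ] f) ∙ (∑[ ys ] f)
  ∑-++ []       ys f = ≈-sym (identityˡ _)
  ∑-++ (x ∷ xs) ys f = ≈-trans (∙-congˡ (∑-++ xs ys f)) (≈-sym (assoc _ _ _))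

  ∑-ε : ∀ (xs : List A) → ∑[ xs ] (λ _ → 0#) ≈ 0#
  ∑-ε []       = ≈-refl
  ∑-ε (x ∷ xs) = ≈-trans (identityˡ _) (∑-ε xs)

  ∑-const : ∀ (xs : List A) c → ∑[ xs ] (λ _ → c) ≈ length xs ⊗ c
  ∑-const []       c = ≈-refl
  ∑-const (x ∷ xs) c = ∙-congˡ (∑-const xs c)

  ∑-comm : ∀ (xs : List A) (ys : List B) (f : A → B → Carrier) →
    ∑[ xs ] (λ x → ∑[ ys ] λ y → f x y) ≈ ∑[ ys ] (λ y → ∑[ xs ] λ x → f x y)
  ∑-comm []       ys f = ≈-sym (∑-ε ys)
  ∑-comm (x ∷ xs) ys f = ≈-trans (∙-congˡ (∑-comm xs ys f)) (≈-sym (∑-∙ ys (f x) _))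

  ∑-map : ∀ (g : A → B) xs f → ∑[ map g xs ] f ≈ ∑[ xs ] (λ x → f (g x))
  ∑-map g []       f = ≈-refl
  ∑-map g (x ∷ xs) f = ∙-congˡ (∑-map g xs f)

  ∑-filter : ∀ {P : Pred A 0ℓ} (P? : Decidable P) xs f → ∑[ filter P? xs ] f ≈ ∑[ xs ] (λ x → f x when P? x)
  ∑-filter P? []       f = ≈-refl
  ∑-filter P? (x ∷ xs) f with P? x
  ... | yes _ = ∙-congˡ (∑-filter P? xs f)
  ... | no _  = ≈-trans (∑-filter P? xs f) (≈-sym (identityˡ _))

  ∑-cartesianProduct : ∀ (xs : List A) (ys : List B) f →
    ∑[ cartesianProduct xs ys ] f ≈ ∑[ xs ] (λ x → ∑[ ys ] λ y → f (x , y))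
  ∑-cartesianProduct []       ys f = ≈-refl
  ∑-cartesianProduct (x ∷ xs) ys f =
    ≈-trans (∑-++ (map (x ,_) ys) _ f) (∙-cong (∑-map (x ,_) ys f) (∑-cartesianProduct xs ys f))

  when-true : ∀ {P : Set} (d : Dec P) {x} → P → x when d ≈ x
  when-true d {x} p = reflexive (cong (λ b → if b then x else 0#) (dec-true d p))

  when-false : ∀ {P : Set} (d : Dec P) {x} → ¬ P → x when d ≈ 0#
  when-false d {x} ¬p = reflexive (cong (λ b → if b then x else 0#) (dec-false d ¬p))

  ∑-⊗ : ∀ {P : Pred A 0ℓ} (P? : Decidable P) xs c → ∑[ xs ] (λ x → c when P? x) ≈ length (filter P? xs) ⊗ c
  ∑-⊗ P? xs c = ≈-trans (≈-sym (∑-filter P? xs (λ _ → c))) (∑-const (filter P? xs) c)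

  ∑-indicator : (_≟_ : DecidableEquality A) → ∀ {xs a} c → Unique xs → a ∈ xs → ∑[ xs ] (λ x → c when (a ≟ x)) ≈ c
  ∑-indicator {A} _≟_ {x ∷ xs} {a} c (a∉ ∷ _) (here refl) = begin
    (c when (a ≟ a)) ∙ ∑[ xs ] (λ x → c when (a ≟ x))  ≈⟨ ∙-cong (when-true (a ≟ a) refl) (absent a∉) ⟩
    c ∙ 0#                                             ≈⟨ identityʳ c ⟩
    c                                                  ∎
    where
    absent : ∀ {ys} → All (a ≢_) ys → ∑[ ys ] (λ x → c when (a ≟ x)) ≈ 0#
    absent []           = ≈-refl
    absent (a≢y ∷ a∉ys) = ≈-trans (∙-cong (when-false (a ≟ _) a≢y) (absent a∉ys)) (identityˡ 0#)
  ∑-indicator _≟_ {x ∷ xs} {a} c (x∉ ∷ unique) (there a∈) =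
    ≈-trans (∙-cong (when-false (a ≟ x) λ { refl → Allₚ.All¬⇒¬Any x∉ a∈ }) (∑-indicator _≟_ c unique a∈)) (identityˡ c)

module _ (M : CommutativeMonoid 0ℓ 0ℓ) {n : ℕ} (G : Graph n) where
  open Graph G using (_~_; _~?_; ~-sym; ~-irrefl)
  open CommutativeMonoid M renaming (refl to ≈-refl; sym to ≈-sym; trans to ≈-trans; ε to 0#)
  open import Algebra.Definitions.RawMonoid rawMonoid using () renaming (_×_ to _⊗_)
  open import Relation.Binary.Reasoning.Setoid setoid
  open ListSum M

  -- Each edge is listed once, with its smaller endpoint first. Transposing the double sum over
  -- second endpoints turns `u < v` into `v < u`, and the two orders together cover every adjacent
  -- pair exactly once.
  handshake : ∀ (g : Fin n → Carrier) → ∑[ edges G ] (λ (u , v) → g u ∙ g v) ≈ ∑[ allFin n ] (λ u → degree G u ⊗ g u)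
  handshake g = begin
    ∑[ edges G ] (λ (u , v) → g u ∙ g v)
      ≈⟨ ∑-∙ (edges G) (λ (u , v) → g u) (λ (u , v) → g v) ⟩
    ∑[ edges G ] (λ (u , v) → g u) ∙ ∑[ edges G ] (λ (u , v) → g v)
      ≈⟨ ∙-cong (expand λ (u , v) → g u) (expand λ (u , v) → g v) ⟩
    ∑[ V ] (λ u → ∑[ V ] λ v → g u when edge? u v) ∙ ∑[ V ] (λ u → ∑[ V ] λ v → g v when edge? u v)
      ≈⟨ ∙-congˡ (∑-comm V V λ u v → g v when edge? u v) ⟩
    ∑[ V ] (λ u → ∑[ V ] λ v → g u when edge? u v) ∙ ∑[ V ] (λ u → ∑[ V ] λ v → g u when edge? v u)
      ≈⟨ ∑-∙ V (λ u → ∑[ V ] λ v → g u when edge? u v) (λ u → ∑[ V ] λ v → g u when edge? v u) ⟨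
    ∑[ V ] (λ u → ∑[ V ] (λ v → g u when edge? u v) ∙ ∑[ V ] λ v → g u when edge? v u)
      ≈⟨ ∑-cong V (λ u → ∑-∙ V (λ v → g u when edge? u v) λ v → g u when edge? v u) ⟨
    ∑[ V ] (λ u → ∑[ V ] λ v → (g u when edge? u v) ∙ (g u when edge? v u))
      ≈⟨ ∑-cong V (λ u → ∑-cong V λ v → either u v) ⟩
    ∑[ V ] (λ u → ∑[ V ] λ v → g u when (u ~? v))
      ≈⟨ ∑-cong V (λ u → ∑-⊗ (u ~?_) V (g u)) ⟩
    ∑[ V ] (λ u → degree G u ⊗ g u)
      ∎
    where
    V : List (Fin n)
    V = allFin n
    edge? : ∀ u v → Dec (u Fin.< v × u ~ v)
    edge? u v = (u Finₚ.<? v) ×-dec (u ~? v)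
    expand : ∀ (f : Fin n × Fin n → Carrier) → ∑[ edges G ] f ≈ ∑[ V ] (λ u → ∑[ V ] λ v → f (u , v) when edge? u v)
    expand f = ≈-trans (∑-filter (λ (u , v) → edge? u v) (cartesianProduct V V) f)
                     (∑-cartesianProduct V V λ (u , v) → f (u , v) when edge? u v)
    either : ∀ u v → (g u when edge? u v) ∙ (g u when edge? v u) ≈ g u when (u ~? v)
    either u v with u ~? v
    ... | no ¬e = ≈-trans (∙-cong (when-false ((u Finₚ.<? v) ×-dec no ¬e) λ (_ , e) → ¬e e)
                                (when-false (edge? v u) λ (_ , e) → ¬e (~-sym e)))
                        (identityˡ 0#)
    ... | yes e with Finₚ.<-cmp u v
    ...   | tri< u<v _ v≮u = ≈-trans (∙-cong (when-true ((u Finₚ.<? v) ×-dec yes e) (u<v , e))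
                                           (when-false (edge? v u) λ (v<u , _) → v≮u v<u))
                                   (identityʳ (g u))
    ...   | tri≈ _ u≡v _   = contradiction e (~-irrefl u≡v)
    ...   | tri> u≮v _ v<u = ≈-trans (∙-cong (when-false ((u Finₚ.<? v) ×-dec yes e) λ (u<v , _) → u≮v u<v)
                                           (when-true (edge? v u) (v<u , ~-sym e)))
                                   (identityˡ (g u))

indegree : ∀ {n} → (Fin n → Fin n) → Fin n → ℕ
indegree {n} s u = length (filter (λ v → s v Finₚ.≟ u) (allFin n))

indegree-image : ∀ {n} (s : Fin n → Fin n) v → 1 ≤ indegree s (s v)
indegree-image s v = ∈-length (∈-filter⁺ (λ w → s w Finₚ.≟ s v) (∈-allFin v) refl)

module _ where
  open ListSum ℕₚ.+-0-commutativeMonoid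
  open import Algebra.Definitions.RawMonoid (CommutativeMonoid.rawMonoid ℕₚ.+-0-commutativeMonoid) using () renaming (_×_ to _⊗_)

  ⊗-1 : ∀ k → k ⊗ 1 ≡ k
  ⊗-1 zero    = refl
  ⊗-1 (suc k) = cong suc (⊗-1 k)

  ∑-count : ∀ {A : Set} {P : Pred A 0ℓ} (P? : Decidable P) xs → ∑[ xs ] (λ x → 1 when P? x) ≡ length (filter P? xs)
  ∑-count P? xs = trans (∑-⊗ P? xs 1) (⊗-1 _)

  sum-map≡∑ : ∀ {A : Set} (f : A → ℕ) xs → sum (map f xs) ≡ ∑[ xs ] f
  sum-map≡∑ f []       = refl
  sum-map≡∑ f (x ∷ xs) = cong (f x +_) (sum-map≡∑ f xs)

  -- Double counting of the pairs `(v , s v)`: grouped by target they give the indegrees, grouped by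
  -- source one per vertex.
  sum-indegree : ∀ {n} (s : Fin n → Fin n) → sum (map (indegree s) (allFin n)) ≡ n
  sum-indegree {n} s = begin
    sum (map (indegree s) V)                              ≡⟨ sum-map≡∑ (indegree s) V ⟩
    ∑[ V ] indegree s                                     ≡⟨ ∑-cong V (λ u → ∑-count (λ v → s v Finₚ.≟ u) V) ⟨
    ∑[ V ] (λ u → ∑[ V ] λ v → 1 when (s v Finₚ.≟ u))     ≡⟨ ∑-comm V V (λ u v → 1 when (s v Finₚ.≟ u)) ⟩
    ∑[ V ] (λ v → ∑[ V ] λ u → 1 when (s v Finₚ.≟ u))     ≡⟨ ∑-cong V (λ v → ∑-indicator Finₚ._≟_ 1 (allFin⁺ n) (∈-allFin (s v))) ⟩
    ∑[ V ] (λ _ → 1)                                      ≡⟨ ∑-const V 1 ⟩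
    length V ⊗ 1                                          ≡⟨ ⊗-1 _ ⟩
    length V                                              ≡⟨ length-tabulate {n = n} id ⟩
    n                                                     ∎
    where
    open ≡-Reasoning
    V : List (Fin n)
    V = allFin n

  module _ {n} {G : Graph n} {s} (o : IsOrientation G s) where
    open Graph G using (_~_; _~?_; ~-sym)
    open IsOrientation o

    -- The neighbours of `u` are `s u` and the preimages of `u` under `s`; `no-swap` keeps `s u` out
    -- of the preimages.
    degree≡1+indegree : ∀ u → degree G u ≡ suc (indegree s u)
    degree≡1+indegree u = begin
      degree G u                                                           ≡⟨ ∑-count (u ~?_) V ⟨
      ∑[ V ] (λ v → 1 when (u ~? v))                                       ≡⟨ ∑-cong V split ⟩
      ∑[ V ] (λ v → (1 when (s u Finₚ.≟ v)) + (1 when (s v Finₚ.≟ u)))     ≡⟨ ∑-∙ V (λ v → 1 when (s u Finₚ.≟ v)) (λ v → 1 when (s v Finₚ.≟ u)) ⟩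
      ∑[ V ] (λ v → 1 when (s u Finₚ.≟ v)) + ∑[ V ] (λ v → 1 when (s v Finₚ.≟ u))
        ≡⟨ cong₂ _+_ (∑-indicator Finₚ._≟_ 1 (allFin⁺ n) (∈-allFin (s u))) (∑-count (λ v → s v Finₚ.≟ u) V) ⟩
      suc (indegree s u)                                                   ∎
      where
      open ≡-Reasoning
      V : List (Fin n)
      V = allFin n
      split : ∀ v → 1 when (u ~? v) ≡ (1 when (s u Finₚ.≟ v)) + (1 when (s v Finₚ.≟ u))
      split v with s u Finₚ.≟ v | s v Finₚ.≟ u
      ... | yes refl | yes eq   = contradiction eq (no-swap u)
      ... | yes refl | no _     = when-true (u ~? s u) (forward u)
      ... | no _     | yes refl = when-true (s v ~? v) (~-sym (forward v))
      ... | no ¬p    | no ¬q    = when-false (u ~? v) λ e → [ ¬p , ¬q ]′ (edge⇒ e)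

    module _ (w : Fin n) where
      private
        a b : Fin n
        a = s w
        b = s a

        s≢ : ∀ v → v ≢ s v
        s≢ v eq = no-swap v (trans (cong s (sym eq)) (sym eq))

        two : ∃[ x ] ∃[ y ] w ≢ s x × w ≢ s y × s x ≢ s y
        two with w Finₚ.≟ b
        ... | yes w≡b = w , b , s≢ w , (λ w≡c → s≢ b (trans (sym w≡b) w≡c)) , λ a≡c → no-swap a (sym a≡c)
        ... | no w≢b  = w , a , s≢ w , w≢b , s≢ a

      -- Among w, s w, s² w, s³ w there are two vertices ≠ w in the image of s.
      indegrees-extract : ∃[ y ] ∃[ z ] ∃[ rest ] map (indegree s) (allFin n) ↭ indegree s w ∷ suc y ∷ suc z ∷ rest
      indegrees-extract with two
      ... | x , y , w≢x , w≢y , x≢y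
        with indegree s (s x) | indegree-image s x | indegree s (s y) | indegree-image s y | perm
        where
        perm : ∃[ rest ] map (indegree s) (allFin n) ↭ indegree s w ∷ indegree s (s x) ∷ indegree s (s y) ∷ rest
        perm with unique-extract (w ∷ s x ∷ s y ∷ [])
                   ((w≢x ∷ w≢y ∷ []) ∷ (x≢y ∷ []) ∷ [] ∷ [])
                   (∈-allFin w ∷ ∈-allFin (s x) ∷ ∈-allFin (s y) ∷ [])
        ... | rest , p = map (indegree s) rest , map⁺ (indegree s) p
      ... | suc i | _ | suc j | _ | rest , p = i , j , rest , p

-- Positive sequences and convexity

ℚ-ring : ACR.AlmostCommutativeRing 0ℓ 0ℓ
ℚ-ring = ACR.fromCommutativeRing ℚₚ.+-*-commutativeRing λ q → dec⇒maybe (0ℚ ℚₚ.≟ q)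

p≤∣p∣ : ∀ p → p ℚ.≤ ℚ.∣ p ∣
p≤∣p∣ p with ℚₚ.≤-total 0ℚ p
... | inj₁ 0≤p = ℚₚ.≤-reflexive (sym (ℚₚ.0≤p⇒∣p∣≡p 0≤p))
... | inj₂ p≤0 = ℚₚ.≤-trans p≤0 (ℚₚ.0≤∣p∣ p)

∣p-q∣≡∣q-p∣ : ∀ p q → ℚ.∣ p ℚ.- q ∣ ≡ ℚ.∣ q ℚ.- p ∣
∣p-q∣≡∣q-p∣ p q = trans (cong ℚ.∣_∣ (flip p q)) (ℚₚ.∣-p∣≡∣p∣ (q ℚ.- p))
  where
  flip : ∀ p q → p ℚ.- q ≡ ℚ.- (q ℚ.- p)
  flip = solve-∀ ℚ-ring

-- Positivity of a real number, stated for bare rational sequences so that differences and products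
-- of approximations need no Cauchy proofs.
Positive : (ℕ → ℚ) → Set
Positive s = ∃[ ε ] 0ℚ ℚ.< ε × Eventually λ m → ε ℚ.< s m

eventually-∩ : ∀ {P Q R : ℕ → Set} → (∀ m → P m → Q m → R m) → Eventually P → Eventually Q → Eventually R
eventually-∩ f (M , p) (N , q) =
  M ⊔ N , λ m h → f m (p m (ℕₚ.m⊔n≤o⇒m≤o M N h)) (q m (ℕₚ.m⊔n≤o⇒n≤o M N h))

positive-resp : ∀ {s t} → (∀ m → s m ≡ t m) → Positive s → Positive t
positive-resp eq (ε , 0<ε , N , h) = ε , 0<ε , N , λ m N≤m → subst (ε ℚ.<_) (eq m) (h m N≤m)

positive-1 : Positive (λ _ → 1ℚ)
positive-1 = ℚ.½ , ℚₚ.positive⁻¹ ℚ.½ , 0 , λ _ _ → toWitness {a? = ℚ.½ ℚₚ.<? 1ℚ} _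

positive-+ : ∀ {s t} → Positive s → Positive t → Positive (λ m → s m ℚ.+ t m)
positive-+ (ε , 0<ε , p) (δ , 0<δ , q) =
  ε ℚ.+ δ , ℚₚ.+-mono-< 0<ε 0<δ , eventually-∩ (λ _ → ℚₚ.+-mono-<) p q

*-mono-<-pos : ∀ {ε δ x y} → 0ℚ ℚ.< ε → 0ℚ ℚ.< δ → ε ℚ.< x → δ ℚ.< y → ε ℚ.* δ ℚ.< x ℚ.* y
*-mono-<-pos {ε} {δ} {x} 0<ε 0<δ ε<x δ<y = ℚₚ.<-trans
  (ℚₚ.*-monoˡ-<-pos δ {{ℚ.positive 0<δ}} ε<x)
  (ℚₚ.*-monoʳ-<-pos x {{ℚ.positive (ℚₚ.<-trans 0<ε ε<x)}} δ<y)

positive-* : ∀ {s t} → Positive s → Positive t → Positive (λ m → s m ℚ.* t m)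
positive-* (ε , 0<ε , p) (δ , 0<δ , q) =
  ε ℚ.* δ , ℚₚ.positive⁻¹ (ε ℚ.* δ) {{ℚₚ.pos*pos⇒pos ε {{ℚ.positive 0<ε}} δ {{ℚ.positive 0<δ}}}} ,
  eventually-∩ (λ _ → *-mono-<-pos 0<ε 0<δ) p q

suc-* : ∀ k x → ((ℤ.+ suc k) / 1) ℚ.* x ≡ x ℚ.+ ((ℤ.+ k) / 1) ℚ.* x
suc-* k x = trans (cong (ℚ._* x) (suc-/1 k)) (expand ((ℤ.+ k) / 1) x)
  where
  expand : ∀ c x → (1ℚ ℚ.+ c) ℚ.* x ≡ x ℚ.+ c ℚ.* x
  expand = solve-∀ ℚ-ring

-- The coefficient `k` may be zero; then `t` alone provides the positivity.
positive-multiple-+ : ∀ k {s t} → Positive s → Positive t → Positive (λ m → ((ℤ.+ k) / 1) ℚ.* s m ℚ.+ t m)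
positive-multiple-+ zero    {s} {t} p q =
  positive-resp (λ m → sym (trans (cong (ℚ._+ t m) (ℚₚ.*-zeroˡ (s m))) (ℚₚ.+-identityˡ (t m)))) q
positive-multiple-+ (suc k) {s} {t} p q =
  positive-resp (λ m → sym (trans (cong (ℚ._+ t m) (suc-* k (s m))) (ℚₚ.+-assoc (s m) _ (t m))))
    (positive-+ p (positive-multiple-+ k p q))

+<⇒<- : ∀ {p q r} → p ℚ.+ q ℚ.< r → q ℚ.< r ℚ.- p
+<⇒<- {p} {q} {r} h = subst (ℚ._< r ℚ.- p) (cancel p q) (ℚₚ.+-monoˡ-< (ℚ.- p) h)
  where
  cancel : ∀ p q → (p ℚ.+ q) ℚ.- p ≡ q
  cancel = solve-∀ ℚ-ring

<-⇒+< : ∀ {p q r} → q ℚ.< r ℚ.- p → p ℚ.+ q ℚ.< r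
<-⇒+< {p} {q} {r} h = subst (p ℚ.+ q ℚ.<_) (cancel p r) (ℚₚ.+-monoʳ-< p h)
  where
  cancel : ∀ p r → p ℚ.+ (r ℚ.- p) ≡ r
  cancel = solve-∀ ℚ-ring

<⇒positive : ∀ {x y} → x <ℝ y → Positive (λ m → seq y m ℚ.- seq x m)
<⇒positive {x} {y} (ε , 0<ε , N , h) = ε , 0<ε , N , λ m N≤m → +<⇒<- {seq x m} (h m N≤m)

positive⇒< : ∀ {x y} → Positive (λ m → seq y m ℚ.- seq x m) → x <ℝ y
positive⇒< {x} {y} (ε , 0<ε , N , h) = ε , 0<ε , N , λ m N≤m → <-⇒+< {seq x m} (h m N≤m)

<⇒≤ℝ : ∀ {x y} → x <ℝ y → x ≤ℝ y
<⇒≤ℝ {x} {y} (ε , 0<ε , N , h) δ 0<δ = N , λ m N≤m →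
  ℚₚ.<-trans (below (seq x m) 0<ε) (ℚₚ.<-trans (h m N≤m) (below (seq y m) 0<δ))
  where
  below : ∀ p {ε} → 0ℚ ℚ.< ε → p ℚ.< p ℚ.+ ε
  below p {ε} 0<ε = subst (ℚ._< p ℚ.+ ε) (ℚₚ.+-identityʳ p) (ℚₚ.+-monoʳ-< p 0<ε)

<⇒≉ℝ : ∀ {x y} → x <ℝ y → ¬ x ≈ℝ y
<⇒≉ℝ {x} {y} (ε , 0<ε , N , h) x≈y with x≈y ε 0<ε
... | M , g = ℚₚ.<-irrefl refl (ℚₚ.<-trans (+<⇒<- {seq x m} (h m (ℕₚ.m≤m⊔n N M)))
                (ℚₚ.≤-<-trans (ℚₚ.≤-trans (p≤∣p∣ _) (ℚₚ.≤-reflexive (∣p-q∣≡∣q-p∣ (seq y m) (seq x m)))) (g m (ℕₚ.m≤n⊔m N M))))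
  where m = N ⊔ M

≐⇒≈ℝ : ∀ {x y} → (∀ m → seq x m ≡ seq y m) → x ≈ℝ y
≐⇒≈ℝ {x} {y} eq ε 0<ε = 0 , λ m _ → subst (λ z → ℚ.∣ z ∣ ℚ.< ε)
  (sym (trans (cong (ℚ._- seq y m) (eq m)) (ℚₚ.+-inverseʳ (seq y m)))) 0<ε

≐⇒≤ℝ : ∀ {x y} → (∀ m → seq x m ≡ seq y m) → x ≤ℝ y
≐⇒≤ℝ {x} {y} eq ε 0<ε = 0 , λ m _ → subst (ℚ._< seq y m ℚ.+ ε) (trans (ℚₚ.+-identityʳ (seq y m)) (sym (eq m)))
  (ℚₚ.+-monoʳ-< (seq y m) 0<ε)

seq-· : ∀ k x m → seq (k · x) m ≡ ((ℤ.+ k) / 1) ℚ.* seq x m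
seq-· zero    x m = sym (ℚₚ.*-zeroˡ (seq x m))
seq-· (suc k) x m = trans (cong (seq x m ℚ.+_) (seq-· k x m)) (sym (suc-* k (seq x m)))

positive-^ : ∀ {a} k → Positive (seq a) → Positive (seq (a ^ k))
positive-^ zero    p = positive-1
positive-^ (suc k) p = positive-* p (positive-^ k p)

-- term a k approximates d a^d for the degree d = k + 1.
term : ℝ → ℕ → ℕ → ℚ
term a k = seq (suc k · a ^ suc k)

StrictlyConvex : (ℕ → ℕ → ℚ) → Set
StrictlyConvex f = ∀ k → Positive λ m → (f k m ℚ.+ f (suc (suc k)) m) ℚ.- (f (suc k) m ℚ.+ f (suc k) m)

seq-term : ∀ a k m → term a k m ≡ (1ℚ ℚ.+ (ℤ.+ k) / 1) ℚ.* (seq a m ℚ.* seq (a ^ k) m)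
seq-term a k m = trans (seq-· (suc k) (a ^ suc k) m) (cong (ℚ._* (seq a m ℚ.* seq (a ^ k) m)) (suc-/1 k))

-- Writes the second difference as a polynomial in `k`, `a` and the power `a ^ k`, which the ring
-- solver can factor.
second-difference : ∀ a k m →
  (term a k m ℚ.+ term a (suc (suc k)) m) ℚ.- (term a (suc k) m ℚ.+ term a (suc k) m) ≡
  (let c = (ℤ.+ k) / 1; x = seq a m; p = seq (a ^ k) m
       t₀ = (1ℚ ℚ.+ c) ℚ.* (x ℚ.* p)
       t₁ = (1ℚ ℚ.+ (1ℚ ℚ.+ c)) ℚ.* (x ℚ.* (x ℚ.* p))
       t₂ = (1ℚ ℚ.+ (1ℚ ℚ.+ (1ℚ ℚ.+ c))) ℚ.* (x ℚ.* (x ℚ.* (x ℚ.* p)))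
   in (t₀ ℚ.+ t₂) ℚ.- (t₁ ℚ.+ t₁))
second-difference a k m = cong₂ ℚ._-_ (cong₂ ℚ._+_ (seq-term a k m) two) (cong₂ ℚ._+_ one one)
  where
  one : _
  one = trans (seq-term a (suc k) m) (cong (λ c → (1ℚ ℚ.+ c) ℚ.* seq (a ^ suc (suc k)) m) (suc-/1 k))
  two : _
  two = trans (seq-term a (suc (suc k)) m) (cong (λ c → (1ℚ ℚ.+ c) ℚ.* seq (a ^ suc (suc (suc k))) m)
          (trans (suc-/1 (suc k)) (cong (1ℚ ℚ.+_) (suc-/1 k))))

-- The second difference is a^(k+1) (a - 1) (k (a - 1) + (3a - 1)). The last summand is split as (a
-- - 1) + a + a, so every part is positive for a > 1.
term-convex-large : ∀ {a} → 1ℝ <ℝ a → StrictlyConvex (term a)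
term-convex-large {a} 1<a k =
  positive-resp (λ m → sym (trans (second-difference a k m) (factor ((ℤ.+ k) / 1) (seq a m) (seq (a ^ k) m))))
    (positive-* (positive-^ (suc k) 0<a) (positive-* 0<a-1 (positive-multiple-+ k 0<a-1 (positive-+ (positive-+ 0<a-1 0<a) 0<a))))
  where
  0<a-1 : Positive (λ m → seq a m ℚ.- 1ℚ)
  0<a-1 = <⇒positive {1ℝ} {a} 1<a
  0<a : Positive (seq a)
  0<a = positive-resp (λ m → cancel (seq a m)) (positive-+ 0<a-1 positive-1)
    where
    cancel : ∀ x → (x ℚ.- 1ℚ) ℚ.+ 1ℚ ≡ x
    cancel = solve-∀ ℚ-ring
  factor : ∀ c x p →
    ((1ℚ ℚ.+ c) ℚ.* (x ℚ.* p) ℚ.+ (1ℚ ℚ.+ (1ℚ ℚ.+ (1ℚ ℚ.+ c))) ℚ.* (x ℚ.* (x ℚ.* (x ℚ.* p)))) ℚ.-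
    ((1ℚ ℚ.+ (1ℚ ℚ.+ c)) ℚ.* (x ℚ.* (x ℚ.* p)) ℚ.+ (1ℚ ℚ.+ (1ℚ ℚ.+ c)) ℚ.* (x ℚ.* (x ℚ.* p))) ≡
    (x ℚ.* p) ℚ.* ((x ℚ.- 1ℚ) ℚ.* (c ℚ.* (x ℚ.- 1ℚ) ℚ.+ (((x ℚ.- 1ℚ) ℚ.+ x) ℚ.+ x)))
  factor = solve-∀ ℚ-ring

-- With both signs reversed, the factors are a^(k+1), 1 - a and k (1 - a) + (1 - 3a). At k = 0 the
-- last one is 1 - 3a, which is where the bound 1/3 comes from.
term-convex-small : ∀ {a} → Positive (seq a) → Positive (λ m → 1ℚ ℚ.- (seq a m ℚ.+ (seq a m ℚ.+ seq a m))) →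
  StrictlyConvex (term a)
term-convex-small {a} 0<a 3a<1 k =
  positive-resp (λ m → sym (trans (second-difference a k m) (factor ((ℤ.+ k) / 1) (seq a m) (seq (a ^ k) m))))
    (positive-* (positive-^ (suc k) 0<a) (positive-* a<1 (positive-multiple-+ k a<1 3a<1)))
  where
  a<1 : Positive (λ m → 1ℚ ℚ.- seq a m)
  a<1 = positive-resp (λ m → cancel (seq a m)) (positive-+ 3a<1 (positive-+ 0<a 0<a))
    where
    cancel : ∀ x → (1ℚ ℚ.- (x ℚ.+ (x ℚ.+ x))) ℚ.+ (x ℚ.+ x) ≡ 1ℚ ℚ.- x
    cancel = solve-∀ ℚ-ring
  factor : ∀ c x p →
    ((1ℚ ℚ.+ c) ℚ.* (x ℚ.* p) ℚ.+ (1ℚ ℚ.+ (1ℚ ℚ.+ (1ℚ ℚ.+ c))) ℚ.* (x ℚ.* (x ℚ.* (x ℚ.* p)))) ℚ.-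
    ((1ℚ ℚ.+ (1ℚ ℚ.+ c)) ℚ.* (x ℚ.* (x ℚ.* p)) ℚ.+ (1ℚ ℚ.+ (1ℚ ℚ.+ c)) ℚ.* (x ℚ.* (x ℚ.* p))) ≡
    (x ℚ.* p) ℚ.* ((1ℚ ℚ.- x) ℚ.* (c ℚ.* (1ℚ ℚ.- x) ℚ.+ (1ℚ ℚ.- (x ℚ.+ (x ℚ.+ x)))))
  factor = solve-∀ ℚ-ring

-- A rational upper bound for e⁻²

-2ℚ ¼ 1/20 : ℚ
-2ℚ  = -[1+ 1 ] / 1
¼    = (ℤ.+ 1) / 4
1/20 = (ℤ.+ 1) / 20

0<1/20 : 0ℚ ℚ.< 1/20
0<1/20 = ℚₚ.positive⁻¹ 1/20

exp-2-partial : expPartialSum -2ℚ 6 ≡ (ℤ.+ 1) / 15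
exp-2-partial = refl

exp-2-term : expTerm -2ℚ 6 ≡ (ℤ.+ 4) / 45
exp-2-term = refl

-- The tail is at most twice its first term, and 1/15 + 2 · 4/45 = 11/45 < 1/4.
exp-2-below : ∀ m → 6 ≤ m → expPartialSum -2ℚ m ℚ.≤ ¼
exp-2-below m 6≤m = begin
  S m                                     ≡⟨ split (S m) (S 6) ⟩
  S 6 ℚ.+ (S m ℚ.- S 6)                   ≤⟨ ℚₚ.+-monoʳ-≤ (S 6) (p≤∣p∣ (S m ℚ.- S 6)) ⟩
  S 6 ℚ.+ ℚ.∣ S m ℚ.- S 6 ∣               ≤⟨ ℚₚ.+-monoʳ-≤ (S 6) tail ⟩
  S 6 ℚ.+ (ℚ.∣ t₆ ∣ ℚ.+ ℚ.∣ t₆ ∣)         ≡⟨ cong₂ (λ p t → p ℚ.+ (ℚ.∣ t ∣ ℚ.+ ℚ.∣ t ∣)) exp-2-partial exp-2-term ⟩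
  bound                                   ≤⟨ toWitness {a? = bound ℚₚ.≤? ¼} _ ⟩
  ¼                                       ∎
  where
  open ℚₚ.≤-Reasoning
  S : ℕ → ℚ
  S = expPartialSum -2ℚ
  t₆ bound : ℚ
  t₆ = expTerm -2ℚ 6
  bound = (ℤ.+ 1) / 15 ℚ.+ (ℚ.∣ (ℤ.+ 4) / 45 ∣ ℚ.+ ℚ.∣ (ℤ.+ 4) / 45 ∣)
  split : ∀ p q → p ≡ q ℚ.+ (p ℚ.- q)
  split = solve-∀ ℚ-ring
  tail : ℚ.∣ S m ℚ.- S 6 ∣ ℚ.≤ ℚ.∣ t₆ ∣ ℚ.+ ℚ.∣ t₆ ∣
  tail = tail-bound S (expTerm -2ℚ) (λ _ → refl) (threshold -2ℚ) (expTerm-halves -2ℚ)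
    -- `threshold -2ℚ` is `4`: from that index on the terms at least halve, so the tail bound
    -- applies at `6`.
    6 m (toWitness {a? = 4 ℕₚ.≤? 6} _) 6≤m

-- Tolerance 1/20 gives a < 1/4 + 1/20 = 3/10 eventually, and 9/10 + 1/20 is still below 1, so 1/20
-- also serves as the positive lower bound.
≤exp-2⇒3a<1 : ∀ {a} → a ≤ℝ exp -2ℚ → Positive (λ m → 1ℚ ℚ.- (seq a m ℚ.+ (seq a m ℚ.+ seq a m)))
≤exp-2⇒3a<1 {a} a≤ = 1/20 , 0<1/20 , eventually-∩ bound (a≤ 1/20 0<1/20) (6 , exp-2-below)
  where
  bound : ∀ m → seq a m ℚ.< expPartialSum -2ℚ m ℚ.+ 1/20 → expPartialSum -2ℚ m ℚ.≤ ¼ →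
    1/20 ℚ.< 1ℚ ℚ.- (seq a m ℚ.+ (seq a m ℚ.+ seq a m))
  bound m h e = +<⇒<- {seq a m ℚ.+ (seq a m ℚ.+ seq a m)}
    (ℚₚ.<-trans (ℚₚ.+-monoˡ-< 1/20 (ℚₚ.+-mono-< a<3/10 (ℚₚ.+-mono-< a<3/10 a<3/10)))
                (toWitness {a? = ((ℤ.+ 3) / 10 ℚ.+ ((ℤ.+ 3) / 10 ℚ.+ (ℤ.+ 3) / 10)) ℚ.+ 1/20 ℚₚ.<? 1ℚ} _))
    where
    a<3/10 : seq a m ℚ.< (ℤ.+ 3) / 10
    a<3/10 = ℚₚ.<-≤-trans h (ℚₚ.+-monoˡ-≤ 1/20 e)

term-convex : ∀ {a} → (1ℝ <ℝ a) ⊎ ((0ℝ <ℝ a) × (a ≤ℝ exp -2ℚ)) → StrictlyConvex (term a)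
term-convex {a} (inj₁ 1<a)        = term-convex-large {a} 1<a
term-convex {a} (inj₂ (0<a , a≤)) = term-convex-small {a}
  (positive-resp (λ m → ℚₚ.+-identityʳ (seq a m)) (<⇒positive {0ℝ} {a} 0<a)) (≤exp-2⇒3a<1 {a} a≤)

-- Majorization

infix 4 _≺_

_≺_ : (s t : ℕ → ℚ) → Set
s ≺ t = Positive λ m → t m ℚ.- s m

module Majorization (f : ℕ → ℕ → ℚ) (convex : StrictlyConvex f) where

  total : List ℕ → ℕ → ℚ
  total []       m = 0ℚ
  total (x ∷ xs) m = f x m ℚ.+ total xs m

  total-∷³ : ∀ x y z xs m → total (x ∷ y ∷ z ∷ xs) m ≡ f x m ℚ.+ (f y m ℚ.+ (f z m ℚ.+ total xs m))
  total-∷³ x y z xs m = refl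

  -- The unit increment of `f` from `suc j + v` exceeds the one from `v`: the difference between
  -- them is a telescoping sum of second differences.
  adjacent-spread : ∀ v j → (λ m → f (suc v) m ℚ.+ f (suc j + v) m) ≺ (λ m → f (suc (suc j + v)) m ℚ.+ f v m)
  adjacent-spread v zero = positive-resp (λ m → flip (f (suc v) m) (f (suc (suc v)) m) (f v m)) (convex v)
    where
    flip : ∀ q r s → (s ℚ.+ r) ℚ.- (q ℚ.+ q) ≡ (r ℚ.+ s) ℚ.- (q ℚ.+ q)
    flip = solve-∀ ℚ-ring
  adjacent-spread v (suc j) = positive-resp
    (λ m → cancel (f (suc v) m) (f (suc j + v) m) (f (suc (suc j + v)) m) (f v m) (f (suc (suc (suc j + v))) m))
    (positive-+ (adjacent-spread v j) (convex (suc j + v)))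
    where
    cancel : ∀ p q r s t → ((r ℚ.+ s) ℚ.- (p ℚ.+ q)) ℚ.+ ((q ℚ.+ t) ℚ.- (r ℚ.+ r)) ≡ (t ℚ.+ s) ℚ.- (p ℚ.+ r)
    cancel = solve-∀ ℚ-ring

  -- Raising `i` by one adds a unit increment to each side. The one on the right starts at the
  -- larger argument and is greater by `adjacent-spread`.
  spread : ∀ v i j → (λ m → f (suc i + v) m ℚ.+ f (suc j + v) m) ≺ (λ m → f (suc i + (suc j + v)) m ℚ.+ f v m)
  spread v zero    j = adjacent-spread v j
  spread v (suc i) j = positive-resp
    (λ m → cancel (f (suc i + v) m) (f (suc j + v) m) (f (suc i + (suc j + v)) m) (f v m)
                  (f (suc (suc i) + v) m) (f (suc (suc i) + (suc j + v)) m))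
    (positive-+ (spread v i j)
      (subst (λ k → (λ m → f (suc (suc i) + v) m ℚ.+ f k m) ≺ (λ m → f (suc k) m ℚ.+ f (suc i + v) m))
             (x∙yz≈y∙xz (suc j) (suc i) v) (adjacent-spread (suc i + v) j)))
    where
    cancel : ∀ p q r s t u → ((r ℚ.+ s) ℚ.- (p ℚ.+ q)) ℚ.+ ((u ℚ.+ p) ℚ.- (t ℚ.+ r)) ≡ (u ℚ.+ s) ℚ.- (t ℚ.+ q)
    cancel = solve-∀ ℚ-ring

  infix 4 _⊑_

  -- The dichotomy keeps track of equality: a chain of moves yields the upper bound and, at the same
  -- time, that only rearrangements attain it.
  data _⊑_ (xs ys : List ℕ) : Set where
    same    : xs ↭ ys → xs ⊑ ys
    smaller : total xs ≺ total ys → xs ⊑ ys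

  total-↭ : ∀ {xs ys} → xs ↭ ys → ∀ m → total xs m ≡ total ys m
  total-↭ ↭.refl        m = refl
  total-↭ (↭.prep x p)  m = cong (f x m ℚ.+_) (total-↭ p m)
  total-↭ (↭.swap {xs} {ys} x y p) m = trans (cong (λ t → f x m ℚ.+ (f y m ℚ.+ t)) (total-↭ p m))
    (exchange (f x m) (f y m) (total ys m))
    where
    exchange : ∀ p q r → p ℚ.+ (q ℚ.+ r) ≡ q ℚ.+ (p ℚ.+ r)
    exchange = solve-∀ ℚ-ring
  total-↭ (↭.trans p q) m = trans (total-↭ p m) (total-↭ q m)

  ⊑-trans : ∀ {xs ys zs} → xs ⊑ ys → ys ⊑ zs → xs ⊑ zs
  ⊑-trans (same p) (same q) = same (↭-trans p q)
  ⊑-trans {zs = zs} (same p) (smaller q) =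
    smaller (positive-resp (λ m → cong (λ t → total zs m ℚ.- t) (total-↭ (↭-sym p) m)) q)
  ⊑-trans {xs} (smaller p) (same q) =
    smaller (positive-resp (λ m → cong (ℚ._- total xs m) (total-↭ q m)) p)
  ⊑-trans {xs} {ys} {zs} (smaller p) (smaller q) =
    smaller (positive-resp (λ m → telescope (total xs m) (total ys m) (total zs m)) (positive-+ p q))
    where
    telescope : ∀ p q r → (q ℚ.- p) ℚ.+ (r ℚ.- q) ≡ r ℚ.- p
    telescope = solve-∀ ℚ-ring

  total-∷-difference : ∀ x xs ys m → total ys m ℚ.- total xs m ≡ total (x ∷ ys) m ℚ.- total (x ∷ xs) m
  total-∷-difference x xs ys m = cancel (f x m) (total xs m) (total ys m)
    where
    cancel : ∀ p q r → r ℚ.- q ≡ (p ℚ.+ r) ℚ.- (p ℚ.+ q)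
    cancel = solve-∀ ℚ-ring

  ⊑-prep : ∀ x {xs ys} → xs ⊑ ys → x ∷ xs ⊑ x ∷ ys
  ⊑-prep x           (same p)    = same (↭.prep x p)
  ⊑-prep x {xs} {ys} (smaller p) = smaller (positive-resp (total-∷-difference x xs ys) p)

  ⊑-drop : ∀ x {xs ys} → x ∷ xs ⊑ x ∷ ys → xs ⊑ ys
  ⊑-drop x           (same p)    = same (drop-∷ p)
  ⊑-drop x {xs} {ys} (smaller p) = smaller (positive-resp (λ m → sym (total-∷-difference x xs ys m)) p)

  -- If one of the surpluses `i`, `j` over `v` is zero, the move only rearranges; otherwise strict
  -- convexity applies.
  ⊑-spread : ∀ v i j xs → i + v ∷ j + v ∷ xs ⊑ i + (j + v) ∷ v ∷ xs
  ⊑-spread v zero    j       xs = same (↭.swap v (j + v) ↭.refl)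
  ⊑-spread v (suc i) zero    xs = same ↭.refl
  ⊑-spread v (suc i) (suc j) xs = smaller (positive-resp
    (λ m → extend (f (suc i + v) m) (f (suc j + v) m) (f (suc i + (suc j + v)) m) (f v m) (total xs m))
    (spread v i j))
    where
    extend : ∀ p q r s t → (r ℚ.+ s) ℚ.- (p ℚ.+ q) ≡ (r ℚ.+ (s ℚ.+ t)) ℚ.- (p ℚ.+ (q ℚ.+ t))
    extend = solve-∀ ℚ-ring

  ⊑-spread-to : ∀ {x y u v} xs → v ≤ x → v ≤ y → u + v ≡ x + y → x ∷ y ∷ xs ⊑ u ∷ v ∷ xs
  ⊑-spread-to {x} {y} {u} {v} xs v≤x v≤y eq =
    subst₂ (λ x y → x ∷ y ∷ xs ⊑ u ∷ v ∷ xs) (ℕₚ.m∸n+n≡m v≤x) (ℕₚ.m∸n+n≡m v≤y)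
      (subst (λ w → (x ∸ v) + v ∷ (y ∸ v) + v ∷ xs ⊑ w ∷ v ∷ xs) (sym u≡) (⊑-spread v (x ∸ v) (y ∸ v) xs))
    where
    u≡ : u ≡ (x ∸ v) + ((y ∸ v) + v)
    u≡ = ℕₚ.+-cancelʳ-≡ v u _ (begin
      u + v                          ≡⟨ eq ⟩
      x + y                          ≡⟨ cong₂ _+_ (ℕₚ.m∸n+n≡m v≤x) (ℕₚ.m∸n+n≡m v≤y) ⟨
      (x ∸ v + v) + (y ∸ v + v)      ≡⟨ xy∙z≈xz∙y (x ∸ v) v (y ∸ v + v) ⟩
      (x ∸ v) + ((y ∸ v) + v) + v    ∎)
      where open ≡-Reasoning

  -- The entries are emptied one by one into `y`, each leaving a `0` behind.
  ⊑-collect : ∀ y xs → y ∷ xs ⊑ y + sum xs ∷ replicate (length xs) 0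
  ⊑-collect y []       = same (↭-reflexive (cong (_∷ []) (sym (ℕₚ.+-identityʳ y))))
  ⊑-collect y (x ∷ xs) = ⊑-trans (⊑-spread-to xs z≤n z≤n (ℕₚ.+-identityʳ (y + x)))
    (⊑-trans (same (↭.swap (y + x) 0 ↭.refl))
    (⊑-trans (⊑-prep 0 (⊑-collect (y + x) xs))
      (same (↭-trans (↭.swap 0 _ ↭.refl) (↭-reflexive (cong (_∷ 0 ∷ replicate (length xs) 0) (ℕₚ.+-assoc y x (sum xs))))))))

  -- The third entry can only be lowered to `1` if it is to stay positive. Its surplus and all
  -- further entries go to the second one, while `M` is kept.
  ⊑-three : ∀ M y z xs →
    M ∷ suc y ∷ suc z ∷ xs ⊑ M ∷ suc (y + z) + sum xs ∷ 1 ∷ replicate (length xs) 0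
  ⊑-three M y z xs = ⊑-prep M
    (⊑-trans (⊑-spread-to xs (s≤s z≤n) (s≤s z≤n) (regroup y z))
    (⊑-trans (same (↭.swap (suc (y + z)) 1 ↭.refl))
    (⊑-trans (⊑-prep 1 (⊑-collect (suc (y + z)) xs))
      (same (↭.swap 1 _ ↭.refl)))))
    where
    regroup : ∀ y z → suc (y + z) + 1 ≡ suc y + suc z
    regroup y z = cong suc (trans (ℕₚ.+-assoc y z 1) (cong (y +_) (ℕₚ.+-comm z 1)))

  padding : ∀ {M} q r s → replicate q M ++ r ∷ replicate (suc s) 0 ↭ 0 ∷ replicate q M ++ r ∷ replicate s 0
  padding zero    r s = ↭.swap r 0 ↭.refl
  padding (suc q) r s = ↭-trans (↭.prep _ (padding q r s)) (↭.swap _ 0 ↭.refl)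

  -- `sum-eq` and `r′<M` form a division with remainder by `M`, which later identifies `q` with the
  -- quotient in the theorem. The entry `r` stands beside `xs`, so `length-eq` does not count the
  -- slot of `r′`.
  record Extremal (M r : ℕ) (xs : List ℕ) : Set where
    field
      q r′ s    : ℕ
      r′<M      : r′ < M
      length-eq : q + s ≡ length xs
      sum-eq    : r + sum xs ≡ q * M + r′
      ⊑-target  : r ∷ xs ⊑ replicate q M ++ r′ ∷ replicate s 0

  -- Greedy filling: r is the partially filled entry, and entries are topped up to M one after the other.
  ⊑-fill : ∀ {M} r xs → r < M → All (_≤ M) xs → Extremal M r xs
  ⊑-fill r [] r<M [] = record
    { q = 0 ; r′ = r ; s = 0 ; r′<M = r<M ; length-eq = refl
    ; sum-eq = ℕₚ.+-identityʳ r ; ⊑-target = same ↭.refl }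
  ⊑-fill {M} r (x ∷ xs) r<M (x≤M ∷ xs≤M) with ℕₚ.<-≤-connex (r + x) M
  ... | inj₁ r+x<M = record
    { q = q ; r′ = r′ ; s = suc s ; r′<M = r′<M
    ; length-eq = trans (ℕₚ.+-suc q s) (cong suc length-eq)
    ; sum-eq = trans (sym (ℕₚ.+-assoc r x (sum xs))) sum-eq
    ; ⊑-target = ⊑-trans (⊑-spread-to xs z≤n z≤n (ℕₚ.+-identityʳ (r + x)))
        (⊑-trans (same (↭.swap (r + x) 0 ↭.refl))
        (⊑-trans (⊑-prep 0 ⊑-target)
          (same (↭-sym (padding q r′ s)))))
    }
    where open Extremal (⊑-fill (r + x) xs r+x<M xs≤M)
  ... | inj₂ M≤r+x = record
    { q = suc q ; r′ = r′ ; s = s ; r′<M = r′<M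
    ; length-eq = cong suc length-eq
    ; sum-eq = trans (carry sum-eq) (sym (ℕₚ.+-assoc M (q * M) r′))
    ; ⊑-target = ⊑-trans (⊑-spread-to xs e≤r e≤x (trans (ℕₚ.+-comm M e) (ℕₚ.m∸n+n≡m M≤r+x))) (⊑-prep M ⊑-target)
    }
    where
    -- When `r + x` reaches `M`, the overflow `e` becomes the new partial entry. It is at most `r`
    -- because `x ≤ M`, and at most `x` because `r < M`, as spreading requires.
    e : ℕ
    e = r + x ∸ M
    e≤r : e ≤ r
    e≤r = ℕₚ.≤-trans (ℕₚ.∸-monoʳ-≤ (r + x) x≤M) (ℕₚ.≤-reflexive (ℕₚ.m+n∸n≡m r x))
    e≤x : e ≤ x
    e≤x = ℕₚ.≤-trans (ℕₚ.∸-monoʳ-≤ (r + x) (ℕₚ.<⇒≤ r<M)) (ℕₚ.≤-reflexive (ℕₚ.m+n∸m≡n r x))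
    carry : ∀ {k t} → e + k ≡ t → r + (x + k) ≡ M + t
    carry {k} {t} eq = begin
      r + (x + k)    ≡⟨ ℕₚ.+-assoc r x k ⟨
      r + x + k      ≡⟨ cong (_+ k) (ℕₚ.m+[n∸m]≡n M≤r+x) ⟨
      M + e + k      ≡⟨ ℕₚ.+-assoc M e k ⟩
      M + (e + k)    ≡⟨ cong (M +_) eq ⟩
      M + t          ∎
      where open ≡-Reasoning
    open Extremal (⊑-fill e xs (ℕₚ.≤-<-trans e≤r r<M) xs≤M)

-- Extremal degree sequences

open ListSum ℚₚ.+-0-commutativeMonoid
open RawMonoidDefinitions (CommutativeMonoid.rawMonoid ℚₚ.+-0-commutativeMonoid) using () renaming (_×_ to _⊗_)

seq-∑ : ∀ {A : Set} (g : A → ℝ) xs m → seq (∑ (map g xs)) m ≡ ∑[ xs ] (λ x → seq (g x) m)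
seq-∑ g []       m = refl
seq-∑ g (x ∷ xs) m = cong (seq (g x) m ℚ.+_) (seq-∑ g xs m)

seq-⊗ : ∀ k x m → seq (k · x) m ≡ k ⊗ seq x m
seq-⊗ zero    x m = refl
seq-⊗ (suc k) x m = cong (seq x m ℚ.+_) (seq-⊗ k x m)

seq-·-+ : ∀ k l x m → seq ((k + l) · x) m ≡ seq (k · x) m ℚ.+ seq (l · x) m
seq-·-+ zero    l x m = sym (ℚₚ.+-identityˡ (seq (l · x) m))
seq-·-+ (suc k) l x m = trans (cong (seq x m ℚ.+_) (seq-·-+ k l x m)) (sym (ℚₚ.+-assoc (seq x m) _ _))

+ℝ-regroup : ∀ x y z w m {t} → t ≡ seq w m →
  seq x m ℚ.+ (seq y m ℚ.+ (seq z m ℚ.+ t)) ≡ seq (x +ℝ y +ℝ z +ℝ w) m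
+ℝ-regroup x y z w m refl = trans (sym (ℚₚ.+-assoc (seq x m) (seq y m) _))
  (sym (ℚₚ.+-assoc (seq x m ℚ.+ seq y m) (seq z m) (seq w m)))

quotient-unique : ∀ {n M q r} .{{_ : NonZero M}} → n ≡ q * M + r → r < M → n ℕ./ M ≡ q
quotient-unique {n} {M} {q} {r} eq r<M = begin
  n ℕ./ M                 ≡⟨ cong (ℕ._/ M) (trans eq (ℕₚ.+-comm (q * M) r)) ⟩
  (r + q * M) ℕ./ M       ≡⟨ ℕ.+-distrib-/-∣ʳ r (divides-refl q) ⟩
  r ℕ./ M + q * M ℕ./ M   ≡⟨ cong₂ _+_ (ℕ.m<n⇒m/n≡0 r<M) (ℕ.m*n/n≡m q M) ⟩
  q                       ∎
  where open ≡-Reasoning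

Descending : List ℕ → Set
Descending = Linked λ x y → y ≤ x

descending-replicate : ∀ {x} k → Descending (replicate k x)
descending-replicate zero          = []
descending-replicate (suc zero)    = [-]
descending-replicate (suc (suc k)) = ℕₚ.≤-refl ∷ descending-replicate (suc k)

descending-∷-replicate : ∀ {x y} k → y ≤ x → Descending (x ∷ replicate k y)
descending-∷-replicate zero    y≤x = [-]
descending-∷-replicate (suc k) y≤x = y≤x ∷ descending-replicate (suc k)

descending-replicate-++ : ∀ {x y ys} k → y ≤ x → Descending (y ∷ ys) → Descending (replicate k x ++ y ∷ ys)
descending-replicate-++ zero          y≤x ↘ = ↘
descending-replicate-++ (suc zero)    y≤x ↘ = y≤x ∷ ↘
descending-replicate-++ (suc (suc k)) y≤x ↘ = ℕₚ.≤-refl ∷ descending-replicate-++ (suc k) y≤x ↘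

-- Sorting permutes its input, and two descending lists that are permutations of each other agree
-- entry by entry.
sort-unique : ∀ {xs ys} → Descending ys → xs ↭ ys → Sort.sort ≥-decTotalOrder xs ≡ ys
sort-unique {xs} ys↘ xs↭ys = Pointwise-≡⇒≡
  (↗↭↗⇒≋ (DecTotalOrder.totalOrder ≥-decTotalOrder) (Sort.sort-↗ ≥-decTotalOrder xs) ys↘
    (↭⇒↭ₛ (↭-trans (Sort.sort-↭ ≥-decTotalOrder xs) xs↭ys)))

module _ (a : ℝ) (convex : StrictlyConvex (term a)) where
  open Majorization (term a) convex

  total-map : ∀ {A : Set} (g : A → ℕ) xs m → total (map g xs) m ≡ ∑[ xs ] (λ x → term a (g x) m)
  total-map g []       m = refl
  total-map g (x ∷ xs) m = cong (term a (g x) m ℚ.+_) (total-map g xs m)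

  total-zeros : ∀ k m → total (replicate k 0) m ≡ seq (k · a) m
  total-zeros zero    m = refl
  total-zeros (suc k) m = cong₂ ℚ._+_ (trans (ℚₚ.+-identityʳ _) (ℚₚ.*-identityʳ (seq a m))) (total-zeros k m)

  total-replicate-++ : ∀ k M xs m → total (replicate k M ++ xs) m ≡ seq ((k * suc M) · a ^ suc M) m ℚ.+ total xs m
  total-replicate-++ zero    M xs m = sym (ℚₚ.+-identityˡ (total xs m))
  total-replicate-++ (suc k) M xs m = begin
    term a M m ℚ.+ total (replicate k M ++ xs) m
      ≡⟨ cong (term a M m ℚ.+_) (total-replicate-++ k M xs m) ⟩
    term a M m ℚ.+ (seq ((k * suc M) · a ^ suc M) m ℚ.+ total xs m)
      ≡⟨ ℚₚ.+-assoc (term a M m) _ _ ⟨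
    (term a M m ℚ.+ seq ((k * suc M) · a ^ suc M) m) ℚ.+ total xs m
      ≡⟨ cong (ℚ._+ total xs m) (seq-·-+ (suc M) (k * suc M) (a ^ suc M) m) ⟨
    seq ((suc k * suc M) · a ^ suc M) m ℚ.+ total xs m
      ∎
    where open ≡-Reasoning

  -- The equations for `d` and `k` let the truncated subtractions of the closed formula stand in
  -- place of `suc y` and `l`.
  few-total : ∀ x {y d} l {k} → suc y ≡ d → l ≡ k → ∀ m →
    total (x ∷ y ∷ 1 ∷ replicate l 0) m ≡ seq (suc x · a ^ suc x +ℝ d · a ^ d +ℝ 2 · a ^ 2 +ℝ k · a) m
  few-total x {y} l refl refl m = trans (total-∷³ x y 1 (replicate l 0) m)
    (+ℝ-regroup (suc x · a ^ suc x) (suc y · a ^ suc y) (2 · a ^ 2) (l · a) m (total-zeros l m))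

  many-total : ∀ q M {r d} t {k} → suc r ≡ d → t ≡ k → ∀ m →
    total (replicate q M ++ r ∷ replicate t 0) m ≡ seq ((q * suc M) · a ^ suc M +ℝ d · a ^ d +ℝ k · a) m
  many-total q M {r} t refl refl m = trans (total-replicate-++ q M (r ∷ replicate t 0) m)
    (trans (cong (λ u → seq ((q * suc M) · a ^ suc M) m ℚ.+ (term a r m ℚ.+ u)) (total-zeros t m))
      (sym (ℚₚ.+-assoc (seq ((q * suc M) · a ^ suc M) m) (term a r m) (seq (t · a) m))))

-- The index as a total over the indegrees

module _ {n : ℕ} {G : Graph n} {s : Fin n → Fin n} (o : IsOrientation G s) where

  indegrees : List ℕ
  indegrees = map (indegree s) (allFin n)

  degrees≡ : map (degree G) (allFin n) ≡ map suc indegrees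
  degrees≡ = trans (map-cong (degree≡1+indegree o) (allFin n)) (map-∘ (allFin n))

  length-indegrees : length indegrees ≡ n
  length-indegrees = trans (length-map (indegree s) (allFin n)) (length-tabulate {n = n} id)

  module _ {M : ℕ} (max≡ : maxDegree G ≡ suc M) where

    indegrees≤M : All (_≤ M) indegrees
    indegrees≤M = All.map s≤s⁻¹ (Allₚ.map⁻ (subst₂ (λ b ds → All (_≤ b) ds) max≡ degrees≡
      (Extrema.xs≤max 0 (map (degree G) (allFin n)))))

    max-attained : ∃[ w ] indegree s w ≡ M
    max-attained with Extrema.argmax-sel id 0 (map (degree G) (allFin n))
    -- The default value `0` of `max` is excluded, since the maximum degree is a successor.
    ... | inj₁ max≡0 = contradiction (trans (sym max≡) max≡0) λ ()
    ... | inj₂ max∈ with ∈-map⁻ (degree G) max∈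
    ...   | w , _ , eq = w , ℕₚ.suc-injective (trans (sym (degree≡1+indegree o w)) (trans (sym eq) max≡))

  module _ (a : ℝ) (convex : StrictlyConvex (term a)) where
    open Majorization (term a) convex

    seq-SEI : ∀ m → seq (SEI a G) m ≡ total indegrees m
    seq-SEI m = begin
      seq (SEI a G) m
        ≡⟨ seq-∑ (λ (u , v) → a ^ degree G u +ℝ a ^ degree G v) (edges G) m ⟩
      ∑[ edges G ] (λ (u , v) → seq (a ^ degree G u) m ℚ.+ seq (a ^ degree G v) m)
        ≡⟨ handshake ℚₚ.+-0-commutativeMonoid G (λ u → seq (a ^ degree G u) m) ⟩
      ∑[ allFin n ] (λ u → degree G u ⊗ seq (a ^ degree G u) m)
        ≡⟨ ∑-cong (allFin n) (λ u → trans (sym (seq-⊗ (degree G u) (a ^ degree G u) m))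
             (cong (λ d → seq (d · a ^ d) m) (degree≡1+indegree o u))) ⟩
      ∑[ allFin n ] (λ u → term a (indegree s u) m)
        ≡⟨ total-map a convex (indegree s) (allFin n) m ⟨
      total indegrees m
        ∎
      where open ≡-Reasoning

    module _ (bound : ℝ) {ys : List ℕ} (bound≡ : ∀ m → total ys m ≡ seq bound m) where

      private
        equal : indegrees ↭ ys → ∀ m → seq (SEI a G) m ≡ seq bound m
        equal p m = trans (seq-SEI m) (trans (total-↭ p m) (bound≡ m))

        strict : total indegrees ≺ total ys → SEI a G <ℝ bound
        strict p = positive⇒< {SEI a G} {bound}
          (positive-resp (λ m → cong₂ ℚ._-_ (bound≡ m) (sym (seq-SEI m))) p)

      SEI-bound : indegrees ⊑ ys → SEI a G ≤ℝ bound
      SEI-bound (same p)    = ≐⇒≤ℝ {SEI a G} {bound} (equal p)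
      SEI-bound (smaller p) = <⇒≤ℝ {SEI a G} {bound} (strict p)

      -- Equality rules out a strictly smaller total, so the indegrees are a permutation of `ys`;
      -- sorting turns this into equality with the descending list. Conversely, sorting only
      -- permutes the degrees, and permutations keep the total.
      SEI-attained : indegrees ⊑ ys → Descending (map suc ys) → SEI a G ≈ℝ bound ⇔ degreeSequence G ≡ map suc ys
      SEI-attained indegrees⊑ ↘ = mk⇔ (to indegrees⊑) (≐⇒≈ℝ {SEI a G} {bound} ∘ equal ∘ from)
        where
        to : indegrees ⊑ ys → SEI a G ≈ℝ bound → degreeSequence G ≡ map suc ys
        to (same p)    _  = sort-unique ↘ (↭-trans (↭-reflexive degrees≡) (map⁺ suc p))
        to (smaller p) eq = contradiction eq (<⇒≉ℝ {SEI a G} {bound} (strict p))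
        pred-map-suc : ∀ xs → map pred (map suc xs) ≡ xs
        pred-map-suc xs = trans (sym (map-∘ xs)) (map-id xs)
        from : degreeSequence G ≡ map suc ys → indegrees ↭ ys
        from eq = subst₂ _↭_ (pred-map-suc indegrees) (pred-map-suc ys) (map⁺ pred
          (↭-trans (↭-reflexive (sym degrees≡))
          (↭-trans (↭-sym (Sort.sort-↭ ≥-decTotalOrder (map (degree G) (allFin n)))) (↭-reflexive eq))))

-- The tuple `𝐳` and the two extremal cases

𝐳-few : ∀ {n Δ} (3≤Δ : 3 ≤ Δ) → quotient n Δ 3≤Δ ≡ 1 ⊎ n ≡ 2 * Δ ∸ 2 →
  𝐳 n Δ 3≤Δ ≡ Δ ∷ n ∸ Δ + 1 ∷ 2 ∷ replicate (n ∸ 3) 1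
𝐳-few {n} {Δ} 3≤Δ few = cong
  (λ b → if b then Δ ∷ n ∸ Δ + 1 ∷ 2 ∷ replicate (n ∸ 3) 1
         else replicate q Δ ++ (n ∸ q * (Δ ∸ 1)) + 1 ∷ replicate (n ∸ q ∸ 1) 1)
  (dec-true ((quotient n Δ 3≤Δ ℕₚ.≟ 1) ⊎-dec (n ℕₚ.≟ 2 * Δ ∸ 2)) few)
  where
  q : ℕ
  q = quotient n Δ 3≤Δ

𝐳-many : ∀ {n Δ} (3≤Δ : 3 ≤ Δ) → 1 < quotient n Δ 3≤Δ × n ≢ 2 * Δ ∸ 2 →
  let q = quotient n Δ 3≤Δ in
  𝐳 n Δ 3≤Δ ≡ replicate q Δ ++ (n ∸ q * (Δ ∸ 1)) + 1 ∷ replicate (n ∸ q ∸ 1) 1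
𝐳-many {n} {Δ} 3≤Δ (1<q , n≢) = cong
  (λ b → if b then Δ ∷ n ∸ Δ + 1 ∷ 2 ∷ replicate (n ∸ 3) 1
         else replicate q Δ ++ (n ∸ q * (Δ ∸ 1)) + 1 ∷ replicate (n ∸ q ∸ 1) 1)
  (dec-false ((quotient n Δ 3≤Δ ℕₚ.≟ 1) ⊎-dec (n ℕₚ.≟ 2 * Δ ∸ 2)) [ (λ q≡1 → ℕₚ.<⇒≢ 1<q (sym q≡1)) , n≢ ]′)
  where
  q : ℕ
  q = quotient n Δ 3≤Δ

-- Serves to show that the tuple of the first case is descending: its second indegree n - Δ is at
-- most `M`.
few⇒n≤2M : ∀ {n M} (3≤Δ : 3 ≤ suc M) → quotient n (suc M) 3≤Δ ≡ 1 ⊎ n ≡ 2 * suc M ∸ 2 → n ≤ M + M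
few⇒n≤2M {n} {M@(suc _)} (s≤s _) (inj₁ q≡1) = begin
  n                         ≡⟨ ℕ.m≡m%n+[m/n]*n n M ⟩
  n ℕ.% M + n ℕ./ M * M     ≡⟨ cong (λ q → n ℕ.% M + q * M) q≡1 ⟩
  n ℕ.% M + (M + 0)         ≤⟨ ℕₚ.+-mono-≤ (ℕₚ.<⇒≤ (ℕ.m%n<n n M)) (ℕₚ.≤-reflexive (ℕₚ.+-identityʳ M)) ⟩
  M + M                     ∎
  where open ℕₚ.≤-Reasoning
few⇒n≤2M {n} {M@(suc M-1)} _ (inj₂ refl) = ℕₚ.≤-reflexive (begin
  M-1 + suc (M + 0)      ≡⟨ ℕₚ.+-suc M-1 (M + 0) ⟩
  M + (M + 0)            ≡⟨ cong (M +_) (ℕₚ.+-identityʳ M) ⟩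
  M + M                  ∎)
  where open ≡-Reasoning

module _ {n : ℕ} {G : Graph n} {s : Fin n → Fin n} (o : IsOrientation G s)
         {M : ℕ} (max≡ : maxDegree G ≡ suc M) (3≤Δ : 3 ≤ suc M)
         (q : ℕ) (quotient≡q : quotient n (suc M) 3≤Δ ≡ q) (a : ℝ) (convex : StrictlyConvex (term a)) where

  open Majorization (term a) convex

  private
    xs : List ℕ
    xs = indegrees o

  -- A vertex of maximum degree supplies the entry `M`, and two further vertices have positive
  -- indegree. The sum and the length of the indegree list, both `n`, fix `y` and `l`.
  few-target : ∃[ y ] ∃[ l ] n ≡ 3 + l × n ≡ suc M + y × 1 ≤ y × xs ⊑ M ∷ y ∷ 1 ∷ replicate l 0
  few-target =
    let w , w≡M        = max-attained o max≡
        y , z , rest , p = indegrees-extract o w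
    in fill y z rest (subst (λ k → xs ↭ k ∷ suc y ∷ suc z ∷ rest) w≡M p)
    where
    regroup : ∀ y z r → M + (suc y + (suc z + r)) ≡ suc M + (suc (y + z) + r)
    regroup y z r = trans (cong (M +_) (cong suc (trans (ℕₚ.+-suc y (z + r)) (cong suc (sym (ℕₚ.+-assoc y z r))))))
      (ℕₚ.+-suc M (suc (y + z + r)))
    fill : ∀ y z rest → xs ↭ M ∷ suc y ∷ suc z ∷ rest →
      ∃[ y ] ∃[ l ] n ≡ 3 + l × n ≡ suc M + y × 1 ≤ y × xs ⊑ M ∷ y ∷ 1 ∷ replicate l 0
    fill y z rest p = suc (y + z) + sum rest , length rest ,
      trans (sym (length-indegrees o)) (↭-length p) ,
      trans (sym (sum-indegree s)) (trans (sum-↭ p) (regroup y z (sum rest))) ,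
      s≤s z≤n ,
      ⊑-trans (same p) (⊑-three M y z rest)

  few-conclusion : ∀ {y d} l {k} bound → (∀ m → total (M ∷ y ∷ 1 ∷ replicate l 0) m ≡ seq bound m) →
    suc y ≡ d → l ≡ k → 1 ≤ y → y ≤ M → xs ⊑ M ∷ y ∷ 1 ∷ replicate l 0 →
    (SEI a G ≤ℝ bound) × (SEI a G ≈ℝ bound ⇔ degreeSequence G ≡ suc M ∷ d ∷ 2 ∷ replicate k 1)
  few-conclusion {y} {d} l {k} bound bound≡ y+1≡d l≡k 1≤y y≤M xs⊑ =
    SEI-bound o a convex bound bound≡ xs⊑ ,
    subst (λ zs → SEI a G ≈ℝ bound ⇔ degreeSequence G ≡ zs) shape
      (SEI-attained o a convex bound bound≡ xs⊑ descending)
    where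
    ones : map suc (replicate l 0) ≡ replicate l 1
    ones = map-replicate suc l 0
    shape : map suc (M ∷ y ∷ 1 ∷ replicate l 0) ≡ suc M ∷ d ∷ 2 ∷ replicate k 1
    shape = cong₂ (λ d zs → suc M ∷ d ∷ 2 ∷ zs) y+1≡d (trans ones (cong (λ k → replicate k 1) l≡k))
    descending : Descending (map suc (M ∷ y ∷ 1 ∷ replicate l 0))
    descending = s≤s y≤M ∷ s≤s 1≤y ∷ subst Descending (sym (cong (2 ∷_) ones)) (descending-∷-replicate l (s≤s z≤n))

  few-case : ∀ d k → d ≡ (n ∸ suc M) + 1 → k ≡ n ∸ 3 → q ≡ 1 ⊎ n ≡ 2 * suc M ∸ 2 →
    let bound = suc M · a ^ suc M +ℝ d · a ^ d +ℝ 2 · a ^ 2 +ℝ k · a in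
    (SEI a G ≤ℝ bound) × (SEI a G ≈ℝ bound ⇔ degreeSequence G ≡ suc M ∷ d ∷ 2 ∷ replicate k 1)
  few-case d k d≡ k≡ few =
    let y , l , n≡3+l , n≡Δ+y , 1≤y , xs⊑ = few-target
    in conclude y l n≡3+l n≡Δ+y 1≤y xs⊑
    where
    conclude : ∀ y l → n ≡ 3 + l → n ≡ suc M + y → 1 ≤ y → xs ⊑ M ∷ y ∷ 1 ∷ replicate l 0 →
      let bound = suc M · a ^ suc M +ℝ d · a ^ d +ℝ 2 · a ^ 2 +ℝ k · a in
      (SEI a G ≤ℝ bound) × (SEI a G ≈ℝ bound ⇔ degreeSequence G ≡ suc M ∷ d ∷ 2 ∷ replicate k 1)
    conclude y l n≡3+l n≡Δ+y 1≤y =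
      few-conclusion l (suc M · a ^ suc M +ℝ d · a ^ d +ℝ 2 · a ^ 2 +ℝ k · a)
        (few-total a convex M l y+1≡d l≡k) y+1≡d l≡k 1≤y y≤M
      where
      y+1≡d : suc y ≡ d
      y+1≡d = trans (cong suc (sym (trans (cong (_∸ suc M) n≡Δ+y) (ℕₚ.m+n∸m≡n (suc M) y))))
        (trans (ℕₚ.+-comm 1 (n ∸ suc M)) (sym d≡))
      l≡k : l ≡ k
      l≡k = trans (sym (cong (_∸ 3) n≡3+l)) (sym k≡)
      y≤M : y ≤ M
      y≤M = ℕₚ.≤-trans (ℕₚ.n≤1+n y) (ℕₚ.+-cancelˡ-≤ M (suc y) M
        (ℕₚ.≤-trans (ℕₚ.≤-reflexive (trans (ℕₚ.+-suc M y) (sym n≡Δ+y))) (few⇒n≤2M 3≤Δ (Sum.map₁ (trans quotient≡q) few))))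

  -- The greedy filling starts from an additional empty entry `0`, which is cancelled at the end
  -- against one of the zeros of the target.
  many-target : 1 < q → ∃[ r ] ∃[ t ] r < M × n ≡ q * M + r × n ≡ q + suc t × xs ⊑ replicate q M ++ r ∷ replicate t 0
  many-target 1<q =
    unpad E.s (trans (sym (length-indegrees o)) (trans (sym E.length-eq) (cong (_+ E.s) (sym q≡))))
      (subst (λ k → 0 ∷ xs ⊑ replicate k M ++ E.r′ ∷ replicate E.s 0) (sym q≡) E.⊑-target)
    where
    0<M : 0 < M
    0<M = ℕₚ.≤-trans (s≤s z≤n) (s≤s⁻¹ 3≤Δ)
    module E = Extremal (⊑-fill 0 xs 0<M (indegrees≤M o max≡))
    n≡′ : n ≡ E.q * M + E.r′
    n≡′ = trans (sym (sum-indegree s)) E.sum-eq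
    q≡ : q ≡ E.q
    q≡ = trans (sym quotient≡q) (quotient-unique {{>-nonZero 0<M}} n≡′ E.r′<M)
    n≡ : n ≡ q * M + E.r′
    n≡ = trans n≡′ (cong (λ k → k * M + E.r′) (sym q≡))
    unpad : ∀ t → n ≡ q + t → 0 ∷ xs ⊑ replicate q M ++ E.r′ ∷ replicate t 0 →
      ∃[ r ] ∃[ t ] r < M × n ≡ q * M + r × n ≡ q + suc t × xs ⊑ replicate q M ++ r ∷ replicate t 0
    -- A zero to cancel exists: otherwise `n` would equal `q`, although `q * M` is at most `n` and
    -- `M` is at least 2.
    unpad zero n≡q+0 _ = contradiction (begin-strict
      q                <⟨ ℕₚ.m<m*n q 2 {{>-nonZero (ℕₚ.<-trans (s≤s z≤n) 1<q)}} (s≤s (s≤s z≤n)) ⟩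
      q * 2            ≤⟨ ℕₚ.*-monoʳ-≤ q (s≤s⁻¹ 3≤Δ) ⟩
      q * M            ≤⟨ ℕₚ.m≤m+n (q * M) E.r′ ⟩
      q * M + E.r′     ≡⟨ n≡ ⟨
      n                ≡⟨ trans n≡q+0 (ℕₚ.+-identityʳ q) ⟩
      q                ∎) (ℕₚ.<-irrefl refl)
      where open ℕₚ.≤-Reasoning
    unpad (suc t) n≡q+t ⊑t = E.r′ , t , E.r′<M , n≡ , n≡q+t , ⊑-drop 0 (⊑-trans ⊑t (same (padding q E.r′ t)))

  many-conclusion : ∀ {r d} t {k} bound → (∀ m → total (replicate q M ++ r ∷ replicate t 0) m ≡ seq bound m) →
    suc r ≡ d → t ≡ k → r < M → xs ⊑ replicate q M ++ r ∷ replicate t 0 →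
    (SEI a G ≤ℝ bound) × (SEI a G ≈ℝ bound ⇔ degreeSequence G ≡ replicate q (suc M) ++ d ∷ replicate k 1)
  many-conclusion {r} {d} t {k} bound bound≡ r+1≡d t≡k r<M xs⊑ =
    SEI-bound o a convex bound bound≡ xs⊑ ,
    subst (λ zs → SEI a G ≈ℝ bound ⇔ degreeSequence G ≡ zs) (trans shape (cong₂ (λ d k → replicate q (suc M) ++ d ∷ replicate k 1) r+1≡d t≡k))
      (SEI-attained o a convex bound bound≡ xs⊑ (subst Descending (sym shape)
        (descending-replicate-++ q (s≤s (ℕₚ.<⇒≤ r<M)) (descending-∷-replicate t (s≤s z≤n)))))
    where
    shape : map suc (replicate q M ++ r ∷ replicate t 0) ≡ replicate q (suc M) ++ suc r ∷ replicate t 1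
    shape = trans (map-++ suc (replicate q M) (r ∷ replicate t 0))
      (cong₂ (λ as bs → as ++ suc r ∷ bs) (map-replicate suc q M) (map-replicate suc t 0))

  many-case : ∀ d k → d ≡ (n ∸ q * M) + 1 → k ≡ n ∸ q ∸ 1 → 1 < q →
    let bound = (q * suc M) · a ^ suc M +ℝ d · a ^ d +ℝ k · a in
    (SEI a G ≤ℝ bound) × (SEI a G ≈ℝ bound ⇔ degreeSequence G ≡ replicate q (suc M) ++ d ∷ replicate k 1)
  many-case d k d≡ k≡ 1<q =
    let r , t , r<M , n≡qM+r , n≡q+1+t , xs⊑ = many-target 1<q
    in conclude r t n≡qM+r n≡q+1+t r<M xs⊑
    where
    conclude : ∀ r t → n ≡ q * M + r → n ≡ q + suc t → r < M → xs ⊑ replicate q M ++ r ∷ replicate t 0 →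
      let bound = (q * suc M) · a ^ suc M +ℝ d · a ^ d +ℝ k · a in
      (SEI a G ≤ℝ bound) × (SEI a G ≈ℝ bound ⇔ degreeSequence G ≡ replicate q (suc M) ++ d ∷ replicate k 1)
    conclude r t n≡qM+r n≡q+1+t =
      many-conclusion t ((q * suc M) · a ^ suc M +ℝ d · a ^ d +ℝ k · a)
        (many-total a convex q M t r+1≡d t≡k) r+1≡d t≡k
      where
      r+1≡d : suc r ≡ d
      r+1≡d = trans (cong suc (sym (trans (cong (_∸ q * M) n≡qM+r) (ℕₚ.m+n∸m≡n (q * M) r))))
        (trans (ℕₚ.+-comm 1 (n ∸ q * M)) (sym d≡))
      t≡k : t ≡ k
      t≡k = trans (sym (cong (_∸ 1) (trans (cong (_∸ q) n≡q+1+t) (ℕₚ.m+n∸m≡n q (suc t))))) (sym k≡)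

theorem4p18 :
    ∀ {n Δ : ℕ} (G : Graph n) → Unicyclic G → 4 ≤ n →
    maxDegree G ≡ Δ → (3≤Δ : 3 ≤ Δ) →
    (a : ℝ) → (1ℝ <ℝ a) ⊎ ((0ℝ <ℝ a) × (a ≤ℝ exp (-[1+ 1 ] / 1))) →
    let q = quotient n Δ 3≤Δ
        d = (n ∸ q * (Δ ∸ 1)) + 1
        bound₁ = Δ · a ^ Δ +ℝ ((n ∸ Δ) + 1) · a ^ ((n ∸ Δ) + 1) +ℝ 2 · a ^ 2 +ℝ (n ∸ 3) · a
        bound₂ = (q * Δ) · a ^ Δ +ℝ d · a ^ d +ℝ (n ∸ q ∸ 1) · a
    in
    ( q ≡ 1 ⊎ n ≡ 2 * Δ ∸ 2 →
        (SEI a G ≤ℝ bound₁) × (SEI a G ≈ℝ bound₁ ⇔ 𝓚 n Δ 3≤Δ G) )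
    ×
    ( 1 < q × n ≢ 2 * Δ ∸ 2 →
        (SEI a G ≤ℝ bound₂) × (SEI a G ≈ℝ bound₂ ⇔ 𝓚 n Δ 3≤Δ G) )
theorem4p18 {n} {suc M} G unicyclic _ max≡ 3≤Δ a range =
  (λ few → in-𝓚 (𝐳-few 3≤Δ few) (few-case oriented max≡ 3≤Δ (quotient n (suc M) 3≤Δ) refl a convex
    ((n ∸ suc M) + 1) (n ∸ 3) refl refl few)) ,
  (λ many → in-𝓚 (𝐳-many 3≤Δ many) (many-case oriented max≡ 3≤Δ (quotient n (suc M) 3≤Δ) refl a convex
    ((n ∸ quotient n (suc M) 3≤Δ * (suc M ∸ 1)) + 1) (n ∸ quotient n (suc M) 3≤Δ ∸ 1) refl refl (proj₁ many)))
  where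
  oriented : IsOrientation G (proj₁ (orientation G unicyclic))
  oriented = proj₂ (orientation G unicyclic)
  convex : StrictlyConvex (term a)
  convex = term-convex {a} range
  in-𝓚 : ∀ {zs} {P Q : Set} → 𝐳 n (suc M) 3≤Δ ≡ zs → P × (Q ⇔ degreeSequence G ≡ zs) → P × (Q ⇔ 𝓚 n (suc M) 3≤Δ G)
  in-𝓚 refl (p , iff) = p , mk⇔ (λ x → unicyclic , Equivalence.to iff x) (λ (_ , eq) → Equivalence.from iff eq)
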